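{- Let $C_m=\frac{1}{m+1}\binom{2m}{m}$ denote the $m$-th Catalan number. Label the vertices of a regular convex $N$-gon by $0,1,\ldots,N-1$ in cyclic order, and for vertices $x\neq y$ and an integer $k\ge 0$ let $f_{xy}(N,k)$ denote the number of triangulations of this $N$-gon containing exactly $k$ diagonals parallel to the segment $xy$. In the sums below, $(i_1,\ldots,i_{k+1})$ ranges over all tuples of positive integers with the indicated sum. (i) If $n\ge 2$ and $k\ge 1$, then \[f_{01}(2n,k)=\sum_{i_1+\cdots+i_{k+1}=n-1} 2^{k+1}C_{2i_1-1}C_{2i_2-1}\cdots C_{2i_{k+1}-1}.\] (ii) If $n\ge 2$ and $k\ge 1$, then \[f_{02}(2n,k)=\sum_{i_1+\cdots+i_{k+1}=n} 2^{k-1}\bigl(2^{2i_1-1}C_{i_1-1}-C_{2i_1-1}\bigr)\bigl(2^{2i_2-1}C_{i_2-1}-C_{2i_2-1}\bigr)C_{2i_3-1}C_{2i_4-1}\cdots C_{2i_{k+1}-1}.\] (iii) If $n\ge 1$ and $k\ge 1$, then \[f_{01}(2n+1,k)=\sum_{i_1+\cdots+i_{k+1}=n} 2^{k}\bigl(2^{2i_1-1}C_{i_1-1}-C_{2i_1-1}\bigr)C_{2i_2-1}C_{2i_3-1}\cdots C_{2i_{k+1}-1}.\]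
   Context: A triangulation of a convex $N$-gon is a maximal set of pairwise non-crossing diagonals (there are $N-3$ of them), viewed as a graph on the vertices $0,\ldots,N-1$ whose edges are the sides $01,12,\ldots,(N-1)0$ together with these diagonals. Here $xy$ may be a side (e.g. $01$) or a diagonal (e.g. $02$) of the regular polygon, and "parallel" means parallel as line segments in the regular $N$-gon (equivalently, $ab$ is parallel to $cd$ iff $a+b\equiv c+d\pmod N$). Empty products (e.g. $C_{2i_3-1}\cdots C_{2i_{k+1}-1}$ when $k=1$) equal $1$. -}

module Defs where

open import Data.Nat
open import Data.Nat.Properties using (<-trans; <-irrefl)
open import Data.Nat.Combinatorics using (_C_)
open import Data.Nat.Divisibility using (_∣_; _∣?_)
open import Data.Integer as ℤ using (ℤ; +_; 0ℤ; 1ℤ)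
open import Data.Product using (_×_; _,_)
open import Data.Product.Properties using (≡-dec)
open import Data.Sum using (_⊎_; inj₁; inj₂)
open import Data.List using (List; []; _∷_; [_]; _++_; map; concatMap; filter; foldr; length; upTo; cartesianProduct)
open import Data.List.Membership.Propositional using (_∈_)
open import Data.List.Membership.Propositional.Properties
  using (∈-filter⁺; ∈-filter⁻; ∈-cartesianProduct⁺; ∈-upTo⁺)
open import Data.List.Relation.Binary.Subset.Propositional using (_⊆_)
open import Data.List.Relation.Unary.All as All using (All; []; _∷_; all?)
open import Data.List.Relation.Unary.Any using (here; there)
open import Relation.Binary using (DecidableEquality)
open import Relation.Binary.PropositionalEquality using (_≡_; refl)
open import Relation.Nullary using (Dec; ¬_; ¬?; map′; _×-dec_; _⊎-dec_; _→-dec_)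

catalan : ℕ → ℕ
catalan m = ((2 * m) C m) / suc m

Segment : Set
Segment = ℕ × ℕ

_≟ₛ_ : DecidableEquality Segment
_≟ₛ_ = ≡-dec _≟_ _≟_

IsSide : ℕ → Segment → Set
IsSide N (a , b) = (b ≡ suc a) ⊎ (a ≡ 0 × suc b ≡ N)

-- Vertices are 0, …, N - 1.  A diagonal is represented once, with its
-- smaller endpoint first.
IsDiagonal : ℕ → Segment → Set
IsDiagonal N (a , b) = a < b × b < N × ¬ IsSide N (a , b)

isDiagonal? : ∀ N d → Dec (IsDiagonal N d)
isDiagonal? N (a , b) =
  a <? b ×-dec b <? N ×-dec ¬? ((b ≟ suc a) ⊎-dec ((a ≟ 0) ×-dec (suc b ≟ N)))

diagonals : ℕ → List Segment
diagonals N = filter (isDiagonal? N) (cartesianProduct (upTo N) (upTo N))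

∈-diagonals⁺ : ∀ {N d} → IsDiagonal N d → d ∈ diagonals N
∈-diagonals⁺ {N} p@(a<b , b<N , _) =
  ∈-filter⁺ (isDiagonal? N)
    (∈-cartesianProduct⁺ (∈-upTo⁺ (<-trans a<b b<N)) (∈-upTo⁺ b<N)) p

∈-diagonals⁻ : ∀ {N d} → d ∈ diagonals N → IsDiagonal N d
∈-diagonals⁻ {N} d∈ with ∈-filter⁻ (isDiagonal? N) {xs = cartesianProduct (upTo N) (upTo N)} d∈
... | _ , p = p

-- Two diagonals cross when they meet in the interior of the polygon, that is,
-- when their endpoints strictly interleave.
Crossing : Segment → Segment → Set
Crossing (a , b) (c , d) = (a < c × c < b × b < d) ⊎ (c < a × a < d × d < b)

crossing? : ∀ d e → Dec (Crossing d e)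
crossing? (a , b) (c , d) =
  (a <? c ×-dec c <? b ×-dec b <? d) ⊎-dec (c <? a ×-dec a <? d ×-dec d <? b)

-- With vertex a of the regular N-gon at angle 2πa/N, the chord ab is perpendicular to the radius at angle
-- π(a + b)/N, so ab and cd are parallel iff a + b ≡ c + d (mod N).
-- In particular every segment is parallel to itself.
Parallel : ℕ → Segment → Segment → Set
Parallel N (a , b) (c , d) = N ∣ ∣ (a + b) - (c + d) ∣

parallel? : ∀ N s t → Dec (Parallel N s t)
parallel? N (a , b) (c , d) = N ∣? ∣ (a + b) - (c + d) ∣

NonCrossing : List Segment → Set
NonCrossing T = ∀ {d e} → d ∈ T → e ∈ T → ¬ Crossing d e

record IsTriangulation (N : ℕ) (T : List Segment) : Set where
  field
    areDiagonals : All (IsDiagonal N) T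
    nonCrossing  : NonCrossing T
    maximal      : ∀ S → All (IsDiagonal N) S → NonCrossing S → T ⊆ S → S ⊆ T

-- Maximality is decided by trying to add one diagonal at a time.
isTriangulation? : ∀ N T → Dec (IsTriangulation N T)
isTriangulation? N T = map′ to from
  (all? (isDiagonal? N) T
    ×-dec all? (λ d → all? (λ e → ¬? (crossing? d e)) T) T
    ×-dec all? (λ d → compatible? d →-dec (d ∈? T)) (diagonals N))
  where
  open import Data.List.Membership.DecPropositional _≟ₛ_ using (_∈?_)

  Compatible : Segment → Set
  Compatible d = All (λ e → ¬ Crossing d e × ¬ Crossing e d) T

  compatible? : ∀ d → Dec (Compatible d)
  compatible? d = all? (λ e → ¬? (crossing? d e) ×-dec ¬? (crossing? e d)) T

  OneStep : Set
  OneStep = All (IsDiagonal N) T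
    × All (λ d → All (λ e → ¬ Crossing d e) T) T
    × All (λ d → Compatible d → d ∈ T) (diagonals N)

  irrefl : ∀ d → ¬ Crossing d d
  irrefl _ (inj₁ (a<a , _)) = <-irrefl refl a<a
  irrefl _ (inj₂ (a<a , _)) = <-irrefl refl a<a

  to : OneStep → IsTriangulation N T
  to (ds , nc , mx) = record
    { areDiagonals = ds
    ; nonCrossing  = λ d∈ e∈ → All.lookup (All.lookup nc d∈) e∈
    ; maximal      = λ S dS ncS T⊆S d∈S →
        All.lookup mx (∈-diagonals⁺ (All.lookup dS d∈S))
          (All.tabulate λ e∈T → ncS d∈S (T⊆S e∈T) , ncS (T⊆S e∈T) d∈S)
    }

  from : IsTriangulation N T → OneStep
  from t = areDiagonals
    , All.tabulate (λ d∈ → All.tabulate (λ e∈ → nonCrossing d∈ e∈))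
    , All.tabulate (λ {d} d∈ c →
        maximal (d ∷ T) (∈-diagonals⁻ d∈ ∷ areDiagonals) (extend c) there (here refl))
    where
    open IsTriangulation t
    extend : ∀ {d} → Compatible d → NonCrossing (d ∷ T)
    extend c (here refl) (here refl) = irrefl _
    extend c (here refl) (there e∈)  = let (p , _) = All.lookup c e∈ in p
    extend c (there d∈)  (here refl) = let (_ , p) = All.lookup c d∈ in p
    extend c (there d∈)  (there e∈)  = nonCrossing d∈ e∈

-- For xs without repetitions, each subset of xs is listed exactly once, with
-- its elements in the order of xs.
subsets : ∀ {A : Set} → List A → List (List A)
subsets []       = [ [] ]
subsets (x ∷ xs) = map (x ∷_) (subsets xs) ++ subsets xs

triangulations : ℕ → List (List Segment)
triangulations N = filter (isTriangulation? N) (subsets (diagonals N))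

parallelCount : ℕ → Segment → List Segment → ℕ
parallelCount N s T = length (filter (λ d → parallel? N d s) T)

-- f x y N k is f_{xy}(N, k).
f : (x y N k : ℕ) → ℕ
f x y N k = length (filter (λ T → parallelCount N (x , y) T ≟ k) (triangulations N))

-- All m-tuples of positive integers with sum n, each listed once.
compositions : (m n : ℕ) → List (List ℕ)
compositions zero    zero    = [ [] ]
compositions zero    (suc n) = []
compositions (suc m) n       =
  concatMap (λ j → map (suc j ∷_) (compositions m (n ∸ suc j))) (upTo n)

sumOver : ∀ {A : Set} → List A → (A → ℤ) → ℤ
sumOver xs g = foldr (λ x s → g x ℤ.+ s) 0ℤ xs

productOver : ∀ {A : Set} → List A → (A → ℤ) → ℤ
productOver xs g = foldr (λ x p → g x ℤ.* p) 1ℤ xs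

-- c i = C_{2i-1} and b i = 2^{2i-1} C_{i-1} - C_{2i-1}; only used for i ≥ 1,
-- where ∸ is exact.
c : ℕ → ℤ
c i = + catalan (2 * i ∸ 1)

b : ℕ → ℤ
b i = + (2 ^ (2 * i ∸ 1) * catalan (i ∸ 1)) ℤ.- c i

module Submission where

-- Rotate the polygon so that the sides in question become v(v + 1) with v = N - 1, and read a
-- triangulation as a binary tree rooted at the side (0, N - 1).  The diagonals parallel to 01 (or 02)
-- are then the segments (a, b) with a + b fixed.  They surround a central side or a central vertex, and
-- only one of the two parts left by the triangle on the root edge can contain the centre.  If x and
-- y are the distances of the ends of the root edge from the centre, the number of triangulations
-- with k parallel diagonals obeys a linear recurrence in (x, y) with Catalan numbers as coefficients
-- in which k changes only on the line x = y.  Decomposing at the points of that line writes the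
-- solution as a convolution of "first return" numbers.  Without regard to k the same recurrence is
-- solved by C_{x+y} and C_{x+y+1}, and comparing the two solutions determines the first returns:
-- they are 2 C_{2i-1} from a point (i, i), and O - 2 O² (with O = Σ C_{2i-1} X^i) from (i, i - 1).
-- Shapiro's identity Σ_i C_{2i} C_{2n-2i} = 4^n C_n turns the latter into 2^{2i-1} C_{i-1} - C_{2i-1}.

-- The rotation has two purposes. A diagonal parallel to 02 has endpoint sum 2 or N + 2; after the
-- rotation the sum is a single integer for either class, N - 1 for 01 and N for 02, so that the
-- class has one centre as seen from the root. Moreover the root edge then lies on the line x = y
-- for 01, and at (x + 1, x), next to it, for 02 and even N. Points far from the line enter
-- nevertheless, because each step of the recurrence lowers one coordinate only. Away from its
-- source term the recurrence is invariant under translation by (1, 1); this makes the values on the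
-- line weights of shifted copies of one solution, which is where the convolution comes from. The
-- constants 2 C_{2i-1} come from splitting the Catalan recurrence by the parity of the left part
-- and cancelling a series with constant term 1. Counting stays in ℕ, so O - 2 O² is represented by
-- `avoiding`, an actual number of triangulations with a subtraction-free equation; integers enter
-- only with the sums over compositions.

open import Defs
open import Algebra.Bundles using (CommutativeSemiring)
open import Algebra.Structures using (IsCommutativeMonoid)
open import Algebra.Structures.Biased using (IsCommutativeSemiringˡ)
import Algebra.Construct.Pointwise as Pointwise
import Algebra.Solver.Ring.NaturalCoefficients.Default as SemiringSolver
open import Data.Bool using (true; false)
open import Data.List
  using (List; []; _∷_; [_]; _++_; map; concatMap; filter; length; take; drop; applyUpTo; cartesianProductWith)
open import Data.List.Properties using (filter-++; filter-none; filter-accept; filter-reject; length-++; ++-assoc; ∷-injectiveʳ)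
open import Data.List.Membership.DecPropositional _≟ₛ_ using (_∈?_)
open import Data.List.Membership.Propositional using (_∈_)
open import Data.List.Membership.Propositional.Properties
open import Data.List.Membership.Propositional.Properties.WithK using (unique∧set⇒bag)
open import Data.List.Relation.Binary.BagAndSetEquality using (∼bag⇒↭)
open import Data.List.Relation.Binary.Permutation.Propositional using (_↭_)
open import Data.List.Relation.Binary.Permutation.Propositional.Properties using (↭-length; filter-↭)
open import Data.List.Relation.Binary.Subset.Propositional using (_⊆_)
open import Data.List.Relation.Unary.All as All using (All; []; _∷_)
import Data.List.Relation.Unary.All.Properties as All
open import Data.List.Relation.Unary.AllPairs using ([]; _∷_)
open import Data.List.Relation.Unary.Any using (here; there)
open import Data.List.Relation.Unary.Unique.Propositional using (Unique)
import Data.List.Relation.Unary.Unique.Propositional.Properties as Unique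
open import Data.Nat
open import Data.Nat.Combinatorics using (_C_)
open import Data.Nat.Combinatorics.Specification using (nCk≡n!/k![n-k]!)
open import Data.Nat.Divisibility using (_∣_; divides; ∣-refl; _∣0)
open import Data.Nat.DivMod using (/-congˡ; /-congʳ; m*n/n≡m)
open import Data.Nat.Induction using (<-rec)
open import Data.Nat.Properties
open import Data.Nat.Tactic.RingSolver using (solve-∀)
open import Data.Product using (_×_; _,_; proj₁; proj₂; ∃; ∃₂)
open import Data.Sum as Sum using (_⊎_; inj₁; inj₂)
open import Function using (_∘_; id; mk⇔)
open import Level using (0ℓ)
open import Relation.Binary using (tri<; tri≈; tri>)
open import Relation.Binary.PropositionalEquality hiding ([_])
open import Relation.Nullary using (Dec; does; yes; no; ¬_; contradiction; _⊎-dec_)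
open import Relation.Unary using (Decidable)

-- Power series over ℕ

Series : Set
Series = ℕ → ℕ

infixl 7 _⊛_ _⋆_ _·_
infixl 6 _⊕_

_⊕_ : Series → Series → Series
(a ⊕ b) n = a n + b n

_·_ : ℕ → Series → Series
(r · a) n = r * a n

-- As power series, a ⊛ b = X · a · b, that is (a ⊛ b) n = Σ_{i < n} a i * b (n - 1 - i),
-- while a ⋆ b is the ordinary product.
_⊛_ : Series → Series → Series
(a ⊛ b) zero    = 0
(a ⊛ b) (suc n) = a 0 * b n + (a ∘ suc ⊛ b) n

_⋆_ : Series → Series → Series
(a ⋆ b) n = (a ⊛ b) (suc n)

infixr 5 _◂_

_◂_ : ℕ → Series → Series
(r ◂ a) zero    = r
(r ◂ a) (suc n) = a n

𝟎 𝟏 X : Series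
𝟎 _ = 0
𝟏   = 1 ◂ 𝟎
X   = 0 ◂ 𝟏

⊛-cong-< : ∀ {a a′ b b′} n → (∀ i → i < n → a i ≡ a′ i) → (∀ i → i < n → b i ≡ b′ i) →
           (a ⊛ b) n ≡ (a′ ⊛ b′) n
⊛-cong-< zero    p q = refl
⊛-cong-< (suc n) p q = cong₂ _+_
  (cong₂ _*_ (p 0 z<s) (q n ≤-refl))
  (⊛-cong-< n (λ i i<n → p (suc i) (s<s i<n)) (λ i i<n → q i (m≤n⇒m≤1+n i<n)))

⊛-cong : ∀ {a a′ b b′} → a ≗ a′ → b ≗ b′ → (a ⊛ b) ≗ (a′ ⊛ b′)
⊛-cong p q n = ⊛-cong-< n (λ i _ → p i) (λ i _ → q i)

⊛-distribʳ : ∀ a b c → ((a ⊕ b) ⊛ c) ≗ (a ⊛ c) ⊕ (b ⊛ c)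
⊛-distribʳ a b c zero    = refl
⊛-distribʳ a b c (suc n) rewrite ⊛-distribʳ (a ∘ suc) (b ∘ suc) c n =
  lemma (a 0) (b 0) (c n) ((a ∘ suc ⊛ c) n) ((b ∘ suc ⊛ c) n)
  where
  lemma : ∀ x y z u v → (x + y) * z + (u + v) ≡ x * z + u + (y * z + v)
  lemma = solve-∀

⊛-distribˡ : ∀ a b c → (a ⊛ (b ⊕ c)) ≗ (a ⊛ b) ⊕ (a ⊛ c)
⊛-distribˡ a b c zero    = refl
⊛-distribˡ a b c (suc n) rewrite ⊛-distribˡ (a ∘ suc) b c n =
  lemma (a 0) (b n) (c n) ((a ∘ suc ⊛ b) n) ((a ∘ suc ⊛ c) n)
  where
  lemma : ∀ x y z u v → x * (y + z) + (u + v) ≡ x * y + u + (x * z + v)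
  lemma = solve-∀

·-⊛-assoc : ∀ r a b → ((r · a) ⊛ b) ≗ r · (a ⊛ b)
·-⊛-assoc r a b zero    = sym (*-zeroʳ r)
·-⊛-assoc r a b (suc n) rewrite ·-⊛-assoc r (a ∘ suc) b n = lemma r (a 0) (b n) ((a ∘ suc ⊛ b) n)
  where
  lemma : ∀ x y z u → x * y * z + x * u ≡ x * (y * z + u)
  lemma = solve-∀

⊛-·-comm : ∀ r a b → (a ⊛ (r · b)) ≗ r · (a ⊛ b)
⊛-·-comm r a b zero    = sym (*-zeroʳ r)
⊛-·-comm r a b (suc n) rewrite ⊛-·-comm r (a ∘ suc) b n = lemma r (a 0) (b n) ((a ∘ suc ⊛ b) n)
  where
  lemma : ∀ x y z u → y * (x * z) + x * u ≡ x * (y * z + u)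
  lemma = solve-∀

⊛-zeroˡ : ∀ b → (𝟎 ⊛ b) ≗ 𝟎
⊛-zeroˡ b zero    = refl
⊛-zeroˡ b (suc n) = ⊛-zeroˡ b n

⊛-last : ∀ a b n → (a ⊛ b) (suc n) ≡ a n * b 0 + (a ⊛ b ∘ suc) n
⊛-last a b zero    = refl
⊛-last a b (suc n) rewrite ⊛-last (a ∘ suc) b n =
  lemma (a 0 * b (suc n)) (a (suc n) * b 0) ((a ∘ suc ⊛ b ∘ suc) n)
  where
  lemma : ∀ x y z → x + (y + z) ≡ y + (x + z)
  lemma = solve-∀

⊛-comm : ∀ a b → (a ⊛ b) ≗ (b ⊛ a)
⊛-comm a b zero    = refl
⊛-comm a b (suc n) = begin
  a 0 * b n + (a ∘ suc ⊛ b) n ≡⟨ cong₂ _+_ (*-comm (a 0) (b n)) (⊛-comm (a ∘ suc) b n) ⟩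
  b n * a 0 + (b ⊛ a ∘ suc) n ≡⟨ ⊛-last b a n ⟨
  (b ⊛ a) (suc n)             ∎
  where open ≡-Reasoning

⊛-zeroʳ : ∀ a → (a ⊛ 𝟎) ≗ 𝟎
⊛-zeroʳ a n = trans (⊛-comm a 𝟎 n) (⊛-zeroˡ a n)

⊛-assoc : ∀ a b c → ((a ⊛ b) ⊛ c) ≗ (a ⊛ (b ⊛ c))
⊛-assoc a b c zero    = refl
⊛-assoc a b c (suc n) = begin
  ((a 0 · b ⊕ (a ∘ suc ⊛ b)) ⊛ c) n            ≡⟨ ⊛-distribʳ (a 0 · b) (a ∘ suc ⊛ b) c n ⟩
  ((a 0 · b) ⊛ c) n + ((a ∘ suc ⊛ b) ⊛ c) n    ≡⟨ cong₂ _+_ (·-⊛-assoc (a 0) b c n) (⊛-assoc (a ∘ suc) b c n) ⟩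
  a 0 * (b ⊛ c) n + (a ∘ suc ⊛ (b ⊛ c)) n      ∎
  where open ≡-Reasoning

⊛-identityˡ : ∀ b → (𝟏 ⊛ b) ≗ 0 ◂ b
⊛-identityˡ b zero    = refl
⊛-identityˡ b (suc n) = trans (cong₂ _+_ (*-identityˡ (b n)) (⊛-zeroˡ b n)) (+-identityʳ (b n))

-- This is `⊛-assoc` with X² divided out. An initial 0 of the left factor of `⊛` disappears by
-- computation, one of the right factor does not; hence the detour through commutativity.
⋆-assoc : ∀ a b c → ((a ⋆ b) ⋆ c) ≗ (a ⋆ (b ⋆ c))
⋆-assoc a b c n = begin
  ((a ⊛ b) ⊛ c) (suc (suc n)) ≡⟨ ⊛-assoc a b c (suc (suc n)) ⟩
  (a ⊛ (b ⊛ c)) (suc (suc n)) ≡⟨ ⊛-comm a (b ⊛ c) (suc (suc n)) ⟩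
  ((b ⊛ c) ⊛ a) (suc (suc n)) ≡⟨⟩
  ((b ⋆ c) ⊛ a) (suc n)       ≡⟨ ⊛-comm (b ⋆ c) a (suc n) ⟩
  (a ⋆ (b ⋆ c)) n             ∎
  where open ≡-Reasoning

X⋆⋆ : ∀ a b → (X ⋆ (a ⋆ b)) ≗ (a ⊛ b)
X⋆⋆ a b zero    = refl
X⋆⋆ a b (suc n) = ⊛-identityˡ (a ⋆ b) (suc n)

seriesSemiring : CommutativeSemiring 0ℓ 0ℓ
seriesSemiring = record
  { isCommutativeSemiring = IsCommutativeSemiringˡ.isCommutativeSemiring record
    { +-isCommutativeMonoid = Pointwise.isCommutativeMonoid ℕ +-0-isCommutativeMonoid
    ; *-isCommutativeMonoid = record
      { isMonoid = record
        { isSemigroup = record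
          { isMagma = record
            { isEquivalence = IsCommutativeMonoid.isEquivalence (Pointwise.isCommutativeMonoid ℕ +-0-isCommutativeMonoid)
            ; ∙-cong = λ p q → ⊛-cong p q ∘ suc
            }
          ; assoc = ⋆-assoc
          }
        ; identity = ⋆-identityˡ , λ a n → trans (⊛-comm a 𝟏 (suc n)) (⋆-identityˡ a n)
        }
      ; comm = λ a b n → ⊛-comm a b (suc n)
      }
    ; distribʳ = λ a b c n → ⊛-distribʳ b c a (suc n)
    ; zeroˡ = λ a n → ⊛-zeroˡ a (suc n)
    }
  }
  where
  ⋆-identityˡ : ∀ a → (𝟏 ⋆ a) ≗ a
  ⋆-identityˡ a n = ⊛-identityˡ a (suc n)

-- Index 1 compares the constant terms of `u` and `v`; once their contribution is cancelled, the
-- tails satisfy the same hypothesis.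
⊛-cancelʳ : ∀ {u v} g → g 0 ≡ 1 → (u ⊛ g) ≗ (v ⊛ g) → u ≗ v
⊛-cancelʳ {u} {v} g g0 eq zero = subst₂ _≡_ (unit u) (unit v) (eq 1)
  where
  unit : ∀ (w : Series) → w 0 * g 0 + 0 ≡ w 0
  unit w = trans (+-identityʳ _) (trans (cong (w 0 *_) g0) (*-identityʳ _))
⊛-cancelʳ {u} {v} g g0 eq (suc n) = ⊛-cancelʳ g g0 eq′ n
  where
  eq′ : (u ∘ suc ⊛ g) ≗ (v ∘ suc ⊛ g)
  eq′ m = +-cancelˡ-≡ (u 0 * g m) _ _
    (trans (eq (suc m)) (cong (λ z → z * g m + (v ∘ suc ⊛ g) m) (sym (⊛-cancelʳ g g0 eq 0))))

-- The two sums collect the left indices i < x and i ≥ x. With i the size of the left subtree, this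
-- tells on which side of the centre the apex of the root triangle lies.
⊛-split : ∀ a b x y → (a ⊛ b) (x + y) ≡ (a ⊛ (λ j → b (j + y))) x + ((λ j → a (x + j)) ⊛ b) y
⊛-split a b zero    y = refl
⊛-split a b (suc x) y rewrite ⊛-split (a ∘ suc) b x y =
  sym (+-assoc (a 0 * b (x + y)) _ _)

double : ℕ → ℕ
double zero    = zero
double (suc n) = suc (suc (double n))

double≡+ : ∀ n → double n ≡ n + n
double≡+ zero    = refl
double≡+ (suc n) = cong suc (trans (cong suc (double≡+ n)) (sym (+-suc n n)))

evens odds : Series → Series
evens a n = a (double n)
odds  a n = a (suc (double n))

-- Because of the factor X, the indices in `(a ⊛ b) n` add up to n - 1: even n pairs opposite
-- parities, odd n equal ones. Dropping the first coefficient of `a` exchanges the two cases.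
⊛-evens : ∀ a b n → (a ⊛ b) (double n) ≡ (evens a ⊛ odds b) n + (odds a ⊛ evens b) n
⊛-odds  : ∀ a b n → (a ⊛ b) (suc (double n)) ≡ (evens a ⋆ evens b) n + (odds a ⊛ odds b) n
⊛-evens a b zero    = refl
⊛-evens a b (suc n) rewrite ⊛-odds (a ∘ suc) b n =
  lemma (a 0 * b (suc (double n))) ((odds a ⋆ evens b) n) ((evens a ∘ suc ⊛ odds b) n)
  where
  lemma : ∀ x y z → x + (y + z) ≡ x + z + y
  lemma = solve-∀
⊛-odds a b n rewrite ⊛-evens (a ∘ suc) b n =
  lemma (a 0 * b (double n)) ((odds a ⊛ odds b) n) ((evens a ∘ suc ⊛ evens b) n)
  where
  lemma : ∀ x y z → x + (y + z) ≡ x + z + y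
  lemma = solve-∀

θ : Series → Series
θ a n = n * a n

-- The Leibniz rule for the Euler operator X d/dX.
θ-⊛ : ∀ a b n → (θ a ⊛ b) (suc n) + (a ⊛ θ b) (suc n) ≡ n * (a ⊛ b) (suc n)
θ-⊛ a b zero    = lemma (a 0)
  where
  lemma : ∀ x → x * 0 + 0 ≡ 0
  lemma = solve-∀
θ-⊛ a b (suc n)
  rewrite ⊛-distribʳ (a ∘ suc) (θ (a ∘ suc)) b (suc n) = begin
  (a ∘ suc ⋆ b) n + (θ (a ∘ suc) ⋆ b) n + (a 0 * (suc n * b (suc n)) + (a ∘ suc ⋆ θ b) n)
    ≡⟨ lemma₁ ((a ∘ suc ⋆ b) n) ((θ (a ∘ suc) ⋆ b) n) (a 0) n (b (suc n)) ((a ∘ suc ⋆ θ b) n) ⟩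
  (a ∘ suc ⋆ b) n + ((θ (a ∘ suc) ⋆ b) n + (a ∘ suc ⋆ θ b) n) + suc n * (a 0 * b (suc n))
    ≡⟨ cong (λ z → (a ∘ suc ⋆ b) n + z + suc n * (a 0 * b (suc n))) (θ-⊛ (a ∘ suc) b n) ⟩
  (a ∘ suc ⋆ b) n + n * (a ∘ suc ⋆ b) n + suc n * (a 0 * b (suc n))
    ≡⟨ lemma₂ ((a ∘ suc ⋆ b) n) n (a 0 * b (suc n)) ⟩
  suc n * (a ⊛ b) (suc (suc n)) ∎
  where
  open ≡-Reasoning
  lemma₁ : ∀ p q x n y r → p + q + (x * ((1 + n) * y) + r) ≡ p + (q + r) + (1 + n) * (x * y)
  lemma₁ = solve-∀
  lemma₂ : ∀ p n y → p + n * p + (1 + n) * y ≡ (1 + n) * (y + p)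
  lemma₂ = solve-∀

-- Binary trees and Catalan numbers

count : ∀ {A : Set} → (A → ℕ) → ℕ → List A → ℕ
count v k xs = length (filter (λ x → v x ≟ k) xs)

count-cong : ∀ {A : Set} {v w : A → ℕ} k xs → (∀ {x} → x ∈ xs → v x ≡ w x) → count v k xs ≡ count w k xs
count-cong         k []       eq = refl
count-cong {w = w} k (x ∷ xs) eq rewrite eq (here refl) with does (w x ≟ k)
... | true  = cong suc (count-cong k xs (eq ∘ there))
... | false = count-cong k xs (eq ∘ there)

count-++ : ∀ {A : Set} (v : A → ℕ) k xs ys → count v k (xs ++ ys) ≡ count v k xs + count v k ys
count-++ v k xs ys rewrite filter-++ (λ x → v x ≟ k) xs ys = length-++ (filter (λ x → v x ≟ k) xs)

count-map : ∀ {A B : Set} (v : B → ℕ) k (φ : A → B) xs → count v k (map φ xs) ≡ count (v ∘ φ) k xs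
count-map v k φ []       = refl
count-map v k φ (x ∷ xs) with does (v (φ x) ≟ k)
... | true  = cong suc (count-map v k φ xs)
... | false = count-map v k φ xs

count-∷ : ∀ {A : Set} (v : A → ℕ) k x xs → count v k (x ∷ xs) ≡ count v k [ x ] + count v k xs
count-∷ v k x xs = count-++ v k [ x ] xs

-- `count (λ n → n) k [ n ]` serves throughout as the indicator of n = k.
count-[] : ∀ {A : Set} (v : A → ℕ) k x → count v k [ x ] ≡ count (λ n → n) k [ v x ]
count-[] v k x with does (v x ≟ k)
... | true  = refl
... | false = refl

count-const : ∀ {A : Set} n k (xs : List A) → count (λ _ → n) k xs ≡ count (λ n → n) k [ n ] * length xs
count-const n k []       = sym (*-zeroʳ (count (λ n → n) k [ n ]))
count-const n k (x ∷ xs) = begin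
  count (λ _ → n) k (x ∷ xs)                       ≡⟨ count-∷ (λ _ → n) k x xs ⟩
  count (λ _ → n) k [ x ] + count (λ _ → n) k xs   ≡⟨ cong₂ _+_ (count-[] (λ _ → n) k x) (count-const n k xs) ⟩
  count (λ n → n) k [ n ] + count (λ n → n) k [ n ] * length xs ≡⟨ *-suc (count (λ n → n) k [ n ]) (length xs) ⟨
  count (λ n → n) k [ n ] * suc (length xs)        ∎
  where open ≡-Reasoning

data Tree : Set where
  leaf : Tree
  node : (l r : Tree) → Tree

size : Tree → ℕ
size leaf       = 0
size (node l r) = suc (size l + size r)

infixl 7 _⊠_

-- The recursion copies that of `⊛`, so that counting turns one into the other summand by summand.
_⊠_ : (ℕ → List Tree) → (ℕ → List Tree) → ℕ → List Tree
(a ⊠ b) zero    = []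
(a ⊠ b) (suc n) = cartesianProductWith node (a 0) (b n) ++ (a ∘ suc ⊠ b) n

⊠-cong : ∀ {a a′ b b′} n → (∀ i → i < n → a i ≡ a′ i) → (∀ i → i < n → b i ≡ b′ i) →
         (a ⊠ b) n ≡ (a′ ⊠ b′) n
⊠-cong zero    p q = refl
⊠-cong (suc n) p q = cong₂ _++_
  (cong₂ (cartesianProductWith node) (p 0 z<s) (q n ≤-refl))
  (⊠-cong n (λ i i<n → p (suc i) (s<s i<n)) (λ i i<n → q i (m≤n⇒m≤1+n i<n)))

⊠-split : ∀ a b x y → (a ⊠ b) (x + y) ≡ (a ⊠ (λ j → b (j + y))) x ++ ((λ j → a (x + j)) ⊠ b) y
⊠-split a b zero    y = refl
⊠-split a b (suc x) y rewrite ⊠-split (a ∘ suc) b x y =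
  sym (++-assoc (cartesianProductWith node (a 0) (b (x + y))) _ _)

∈-⊠⁻ : ∀ a b n {t} → t ∈ (a ⊠ b) n →
       ∃₂ λ i j → suc (i + j) ≡ n × ∃₂ λ l r → l ∈ a i × r ∈ b j × t ≡ node l r
∈-⊠⁻ a b (suc n) t∈ with ∈-++⁻ (cartesianProductWith node (a 0) (b n)) t∈
... | inj₁ t∈₁ =
  let l , r , l∈ , r∈ , eq = ∈-cartesianProductWith⁻ node (a 0) (b n) t∈₁
  in 0 , n , refl , l , r , l∈ , r∈ , eq
... | inj₂ t∈₂ =
  let i , j , eq , rest = ∈-⊠⁻ (a ∘ suc) b n t∈₂ in suc i , j , cong suc eq , rest

∈-⊠⁺ : ∀ a b {l r} i j → l ∈ a i → r ∈ b j → node l r ∈ (a ⊠ b) (suc (i + j))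
∈-⊠⁺ a b zero    j l∈ r∈ = ∈-++⁺ˡ (∈-cartesianProductWith⁺ node l∈ r∈)
∈-⊠⁺ a b (suc i) j l∈ r∈ =
  ∈-++⁺ʳ (cartesianProductWith node (a 0) (b (suc (i + j)))) (∈-⊠⁺ (a ∘ suc) b i j l∈ r∈)

-- The first argument is fuel; it suffices that it is at least the size.
treesWithin : ℕ → ℕ → List Tree
treesWithin f       zero    = [ leaf ]
treesWithin zero    (suc m) = []
treesWithin (suc f) (suc m) = (treesWithin f ⊠ treesWithin f) (suc m)

treesWithin-fuel : ∀ {f g m} → m ≤ f → m ≤ g → treesWithin f m ≡ treesWithin g m
treesWithin-fuel {m = zero} _ _ = refl
treesWithin-fuel {suc f} {suc g} {suc m} (s≤s m≤f) (s≤s m≤g) = ⊠-cong (suc m) eq eq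
  where
  eq : ∀ i → i < suc m → treesWithin f i ≡ treesWithin g i
  eq i (s≤s i≤m) = treesWithin-fuel (≤-trans i≤m m≤f) (≤-trans i≤m m≤g)

trees : ℕ → List Tree
trees m = treesWithin m m

trees-suc : ∀ m → trees (suc m) ≡ (trees ⊠ trees) (suc m)
trees-suc m = ⊠-cong (suc m) eq eq
  where
  eq : ∀ i → i < suc m → treesWithin m i ≡ trees i
  eq i (s≤s i≤m) = treesWithin-fuel i≤m ≤-refl

∈-trees⁻ : ∀ m {t} → t ∈ trees m → size t ≡ m
∈-trees⁻ = <-rec _ go
  where
  go : ∀ m → (∀ {i} → i < m → ∀ {t} → t ∈ trees i → size t ≡ i) → ∀ {t} → t ∈ trees m → size t ≡ m
  go zero    rec (here refl) = refl
  go (suc m) rec {t} t∈ with ∈-⊠⁻ trees trees (suc m) (subst (t ∈_) (trees-suc m) t∈)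
  ... | i , j , refl , l , r , l∈ , r∈ , refl =
    cong suc (cong₂ _+_ (rec (s≤s (m≤m+n i j)) l∈) (rec (s≤s (m≤n+m j i)) r∈))

∈-trees⁺ : ∀ t → t ∈ trees (size t)
∈-trees⁺ leaf       = here refl
∈-trees⁺ (node l r) = subst (node l r ∈_) (sym (trees-suc (size l + size r)))
  (∈-⊠⁺ trees trees (size l) (size r) (∈-trees⁺ l) (∈-trees⁺ r))

node-injective : ∀ {l l′ r r′} → node l r ≡ node l′ r′ → l ≡ l′ × r ≡ r′
node-injective refl = refl , refl

-- Trees from different summands differ in the size of the left subtree. The offset `o` records how
-- often `a` has been shifted by `suc`.
⊠-unique : ∀ a b n o → (∀ i → i < n → Unique (a i)) → (∀ i → i < n → Unique (b i)) →
           (∀ i → i < n → ∀ {t} → t ∈ a i → size t ≡ o + i) → Unique ((a ⊠ b) n)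
⊠-unique a b zero    o ua ub sz = []
⊠-unique a b (suc n) o ua ub sz = Unique.++⁺
  (Unique.cartesianProductWith⁺ node node-injective (ua 0 z<s) (ub n ≤-refl))
  (⊠-unique (a ∘ suc) b n (suc o) (λ i i<n → ua (suc i) (s<s i<n)) (λ i i<n → ub i (m≤n⇒m≤1+n i<n))
    λ i i<n t∈ → trans (sz (suc i) (s<s i<n) t∈) (+-suc o i))
  λ (t∈₁ , t∈₂) → disjoint (∈-cartesianProductWith⁻ node (a 0) (b n) t∈₁) (∈-⊠⁻ (a ∘ suc) b n t∈₂)
  where
  disjoint : ∀ {t} → (∃₂ λ l r → l ∈ a 0 × r ∈ b n × t ≡ node l r) →
             ¬ (∃₂ λ i j → suc (i + j) ≡ n × ∃₂ λ l r → l ∈ a (suc i) × r ∈ b j × t ≡ node l r)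
  disjoint (l , r , l∈ , _ , refl) (i , j , refl , _ , _ , l∈′ , _ , refl) =
    contradiction (+-cancelˡ-≡ o 0 (suc i) (trans (sym (sz 0 z<s l∈)) (sz (suc i) (s<s (s≤s (m≤m+n i j))) l∈′))) λ ()

trees-unique : ∀ m → Unique (trees m)
trees-unique = <-rec _ go
  where
  go : ∀ m → (∀ {i} → i < m → Unique (trees i)) → Unique (trees m)
  go zero    rec = [] ∷ []
  go (suc m) rec = subst Unique (sym (trees-suc m))
    (⊠-unique trees trees (suc m) 0 (λ i i<m → rec i<m) (λ i i<m → rec i<m) (λ i _ → ∈-trees⁻ i))

count-productʳ : ∀ (v w : Tree → ℕ) k xs ys → (∀ {l r} → l ∈ xs → r ∈ ys → v (node l r) ≡ w r) →
                 count v k (cartesianProductWith node xs ys) ≡ length xs * count w k ys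
count-productʳ v w k []       ys eq = refl
count-productʳ v w k (x ∷ xs) ys eq = begin
  count v k (map (node x) ys ++ cartesianProductWith node xs ys)
    ≡⟨ count-++ v k (map (node x) ys) _ ⟩
  count v k (map (node x) ys) + count v k (cartesianProductWith node xs ys)
    ≡⟨ cong₂ _+_ (trans (count-map v k (node x) ys) (count-cong k ys (eq (here refl))))
                 (count-productʳ v w k xs ys (eq ∘ there)) ⟩
  count w k ys + length xs * count w k ys ∎
  where open ≡-Reasoning

count-productˡ : ∀ (v w : Tree → ℕ) k xs ys → (∀ {l r} → l ∈ xs → r ∈ ys → v (node l r) ≡ w l) →
                 count v k (cartesianProductWith node xs ys) ≡ count w k xs * length ys
count-productˡ v w k []       ys eq = refl
count-productˡ v w k (x ∷ xs) ys eq = begin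
  count v k (map (node x) ys ++ cartesianProductWith node xs ys)
    ≡⟨ count-++ v k (map (node x) ys) _ ⟩
  count v k (map (node x) ys) + count v k (cartesianProductWith node xs ys)
    ≡⟨ cong₂ _+_ (trans (count-map v k (node x) ys) (trans (count-cong k ys (eq (here refl))) (trans (count-const (w x) k ys) (cong (_* length ys) (sym (count-[] w k x))))))
                 (count-productˡ v w k xs ys (eq ∘ there)) ⟩
  count w k [ x ] * length ys + count w k xs * length ys
    ≡⟨ *-distribʳ-+ (length ys) (count w k [ x ]) (count w k xs) ⟨
  (count w k [ x ] + count w k xs) * length ys
    ≡⟨ cong (_* length ys) (count-∷ w k x xs) ⟨
  count w k (x ∷ xs) * length ys ∎
  where
  open ≡-Reasoning

count-⊠ʳ : ∀ (v : Tree → ℕ) (w : ℕ → Tree → ℕ) k a b n →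
           (∀ i j → suc (i + j) ≡ n → ∀ {l r} → l ∈ a i → r ∈ b j → v (node l r) ≡ w j r) →
           count v k ((a ⊠ b) n) ≡ ((length ∘ a) ⊛ (λ j → count (w j) k (b j))) n
count-⊠ʳ v w k a b zero    eq = refl
count-⊠ʳ v w k a b (suc n) eq = trans
  (count-++ v k (cartesianProductWith node (a 0) (b n)) _)
  (cong₂ _+_ (count-productʳ v (w n) k (a 0) (b n) (eq 0 n refl))
             (count-⊠ʳ v w k (a ∘ suc) b n λ i j e → eq (suc i) j (cong suc e)))

count-⊠ˡ : ∀ (v : Tree → ℕ) (w : ℕ → Tree → ℕ) k a b n →
           (∀ i j → suc (i + j) ≡ n → ∀ {l r} → l ∈ a i → r ∈ b j → v (node l r) ≡ w i l) →
           count v k ((a ⊠ b) n) ≡ ((λ i → count (w i) k (a i)) ⊛ (length ∘ b)) n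
count-⊠ˡ v w k a b zero    eq = refl
count-⊠ˡ v w k a b (suc n) eq = trans
  (count-++ v k (cartesianProductWith node (a 0) (b n)) _)
  (cong₂ _+_ (count-productˡ v (w 0) k (a 0) (b n) (eq 0 n refl))
             (count-⊠ˡ v (w ∘ suc) k (a ∘ suc) b n λ i j e → eq (suc i) j (cong suc e)))

Cat : Series
Cat m = length (trees m)

count-all : ∀ {A : Set} (xs : List A) → count (λ _ → 0) 0 xs ≡ length xs
count-all xs = trans (count-const 0 0 xs) (*-identityˡ (length xs))

Cat-suc : ∀ m → Cat (suc m) ≡ (Cat ⋆ Cat) m
Cat-suc m = begin
  length (trees (suc m))                        ≡⟨ cong length (trees-suc m) ⟩
  length ((trees ⊠ trees) (suc m))              ≡⟨ count-all ((trees ⊠ trees) (suc m)) ⟨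
  count (λ _ → 0) 0 ((trees ⊠ trees) (suc m))   ≡⟨ count-⊠ʳ (λ _ → 0) (λ _ _ → 0) 0 trees trees (suc m) (λ _ _ _ _ _ → refl) ⟩
  (Cat ⊛ (λ j → count (λ _ → 0) 0 (trees j))) (suc m) ≡⟨ ⊛-cong {a = Cat} (λ _ → refl) (λ j → count-all (trees j)) (suc m) ⟩
  (Cat ⋆ Cat) m                                 ∎
  where open ≡-Reasoning

-- By symmetry of the convolution, 2 Σ i C_i C_{n-i} = n C_{n+1} (`θ-Cat`). At n + 1 this writes (n
-- + 3) C_{n+2} as 2 Σ (i + 1) C_i C_{n+1-i}; the induction hypothesis lowers i in every term with i
-- > 0, and `θ-Cat` at n evaluates the rest.
Cat-rec : ∀ n → (2 + n) * Cat (suc n) ≡ (4 * n + 2) * Cat n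
Cat-rec = <-rec _ go
  where
  open ≡-Reasoning
  θ-Cat : ∀ n → (θ Cat ⋆ Cat) n + (θ Cat ⋆ Cat) n ≡ n * Cat (suc n)
  θ-Cat n = begin
    (θ Cat ⋆ Cat) n + (θ Cat ⋆ Cat) n ≡⟨ cong ((θ Cat ⋆ Cat) n +_) (⊛-comm (θ Cat) Cat (suc n)) ⟩
    (θ Cat ⋆ Cat) n + (Cat ⋆ θ Cat) n ≡⟨ θ-⊛ Cat Cat n ⟩
    n * (Cat ⋆ Cat) n                 ≡⟨ cong (n *_) (Cat-suc n) ⟨
    n * Cat (suc n)                   ∎

  go : ∀ n → (∀ {i} → i < n → (2 + i) * Cat (suc i) ≡ (4 * i + 2) * Cat i) →
       (2 + n) * Cat (suc n) ≡ (4 * n + 2) * Cat n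
  go zero    rec = refl
  go (suc n) rec = begin
    (3 + n) * S
      ≡⟨ lemma₁ n S ⟩
    suc n * S + 2 * S
      ≡⟨ cong (_+ 2 * S) (θ-Cat (suc n)) ⟨
    T + T + 2 * S
      ≡⟨ lemma₂ T S ⟩
    2 * (T + S)
      ≡⟨ cong (λ s → 2 * (T + s)) (Cat-suc (suc n)) ⟩
    2 * (T + (Cat ⋆ Cat) (suc n))
      ≡⟨ cong (2 *_) (⊛-distribʳ (θ Cat) Cat Cat (suc (suc n))) ⟨
    2 * (1 * Cat (suc n) + ((θ Cat ⊕ Cat) ∘ suc ⊛ Cat) (suc n))
      ≡⟨ cong (λ s → 2 * (1 * Cat (suc n) + s)) (⊛-cong-< (suc n) step (λ _ _ → refl)) ⟩
    2 * (1 * Cat (suc n) + ((4 · θ Cat ⊕ 2 · Cat) ⊛ Cat) (suc n))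
      ≡⟨ cong (λ s → 2 * (1 * Cat (suc n) + s)) (⊛-distribʳ (4 · θ Cat) (2 · Cat) Cat (suc n)) ⟩
    2 * (1 * Cat (suc n) + ((4 · θ Cat ⋆ Cat) n + (2 · Cat ⋆ Cat) n))
      ≡⟨ cong₂ (λ s t → 2 * (1 * Cat (suc n) + (s + t)))
           (·-⊛-assoc 4 (θ Cat) Cat (suc n)) (trans (·-⊛-assoc 2 Cat Cat (suc n)) (cong (2 *_) (sym (Cat-suc n)))) ⟩
    2 * (1 * Cat (suc n) + (4 * (θ Cat ⋆ Cat) n + 2 * Cat (suc n)))
      ≡⟨ lemma₃ (Cat (suc n)) ((θ Cat ⋆ Cat) n) ⟩
    6 * Cat (suc n) + 4 * ((θ Cat ⋆ Cat) n + (θ Cat ⋆ Cat) n)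
      ≡⟨ cong (λ s → 6 * Cat (suc n) + 4 * s) (θ-Cat n) ⟩
    6 * Cat (suc n) + 4 * (n * Cat (suc n))
      ≡⟨ lemma₄ n (Cat (suc n)) ⟩
    (4 * suc n + 2) * Cat (suc n) ∎
    where
    S = Cat (suc (suc n))
    T = (θ Cat ⋆ Cat) (suc n)
    step : ∀ i → i < suc n → (θ Cat ⊕ Cat) (suc i) ≡ (4 · θ Cat ⊕ 2 · Cat) i
    step i i≤n = trans (lemma₅ i (Cat (suc i))) (trans (rec i≤n) (lemma₆ i (Cat i)))
      where
      lemma₅ : ∀ i c → (1 + i) * c + c ≡ (2 + i) * c
      lemma₅ = solve-∀
      lemma₆ : ∀ i c → (4 * i + 2) * c ≡ 4 * (i * c) + 2 * c
      lemma₆ = solve-∀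
    lemma₁ : ∀ n s → (3 + n) * s ≡ (1 + n) * s + 2 * s
    lemma₁ = solve-∀
    lemma₂ : ∀ t s → t + t + 2 * s ≡ 2 * (t + s)
    lemma₂ = solve-∀
    lemma₃ : ∀ c t → 2 * (1 * c + (4 * t + 2 * c)) ≡ 6 * c + 4 * (t + t)
    lemma₃ = solve-∀
    lemma₄ : ∀ n c → 6 * c + 4 * (n * c) ≡ (4 * (1 + n) + 2) * c
    lemma₄ = solve-∀

Cat-factorial : ∀ m → suc m * Cat m * (m ! * m !) ≡ (m + m) !
Cat-factorial zero    = refl
Cat-factorial (suc m) = begin
  suc (suc m) * Cat (suc m) * (suc m * m ! * (suc m * m !))
    ≡⟨ cong (_* (suc m * m ! * (suc m * m !))) (Cat-rec m) ⟩
  (4 * m + 2) * Cat m * (suc m * m ! * (suc m * m !))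
    ≡⟨ lemma m (Cat m) (m !) ⟩
  suc (suc (m + m)) * (suc (m + m) * (suc m * Cat m * (m ! * m !)))
    ≡⟨ cong (λ s → suc (suc (m + m)) * (suc (m + m) * s)) (Cat-factorial m) ⟩
  suc (suc (m + m)) !
    ≡⟨ cong (λ s → suc s !) (+-suc m m) ⟨
  (suc m + suc m) ! ∎
  where
  open ≡-Reasoning
  lemma : ∀ m c p → (4 * m + 2) * c * ((1 + m) * p * ((1 + m) * p)) ≡ (2 + (m + m)) * ((1 + (m + m)) * ((1 + m) * c * (p * p)))
  lemma = solve-∀

catalan≡Cat : ∀ m → catalan m ≡ Cat m
catalan≡Cat m = begin
  ((2 * m) C m) / suc m      ≡⟨ /-congˡ {o = suc m} central ⟩
  suc m * Cat m / suc m      ≡⟨ cong (_/ suc m) (*-comm (suc m) (Cat m)) ⟩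
  Cat m * suc m / suc m      ≡⟨ m*n/n≡m (Cat m) (suc m) ⟩
  Cat m                      ∎
  where
  open ≡-Reasoning
  instance
    _ = m !* m !≢0
    _ = m !* (2 * m ∸ m) !≢0
  central : (2 * m) C m ≡ suc m * Cat m
  central = begin
    (2 * m) C m                                ≡⟨ nCk≡n!/k![n-k]! (m≤n*m m 2) ⟩
    (2 * m) ! / (m ! * (2 * m ∸ m) !)          ≡⟨ /-congʳ (cong (λ s → m ! * s !) (trans (m+n∸m≡n m (m + 0)) (+-identityʳ m))) ⟩
    (2 * m) ! / (m ! * m !)                    ≡⟨ /-congˡ {o = m ! * m !} (trans (cong (λ s → (m + s) !) (+-identityʳ m)) (sym (Cat-factorial m))) ⟩
    suc m * Cat m * (m ! * m !) / (m ! * m !)  ≡⟨ m*n/n≡m (suc m * Cat m) (m ! * m !) ⟩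
    suc m * Cat m                              ∎

-- Counting central edges

double-+ : ∀ m n → double (m + n) ≡ double m + double n
double-+ zero    n = refl
double-+ (suc m) n = cong (suc ∘ suc) (double-+ m n)

double-mono : ∀ {m n} → m ≤ n → double m ≤ double n
double-mono z≤n       = z≤n
double-mono (s≤s m≤n) = s≤s (s≤s (double-mono m≤n))

n≤double : ∀ n → n ≤ double n
n≤double zero    = z≤n
n≤double (suc n) = s≤s (m≤n⇒m≤1+n (n≤double n))

-- For a tree triangulating the vertices lo, …, lo + 1 + size t, these count the edges (a , b)
-- with a + b ≡ 2 * lo + d: central those below the root edge, centralEdge also the root edge
-- itself unless it is a side.
central centralEdge : ℕ → Tree → ℕ
central d leaf       = 0
central d (node l r) = centralEdge d l + centralEdge (d ∸ double (suc (size l))) r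
centralEdge d leaf         = 0
centralEdge d t@(node _ _) = count (λ n → n) d [ suc (size t) ] + central d t

-- Two different vertices have a sum above 2 * lo. This makes the truncated subtraction in `central`
-- harmless: it gives 0 when the wanted sum is too small for the right part.
central-0     : ∀ t → central 0 t ≡ 0
centralEdge-0 : ∀ t → centralEdge 0 t ≡ 0
central-0 leaf       = refl
central-0 (node l r) = cong₂ _+_ (centralEdge-0 l) (centralEdge-0 r)
centralEdge-0 leaf       = refl
centralEdge-0 t@(node _ _) = central-0 t

count-[]-≢ : ∀ {m n} → m ≢ n → count (λ n → n) n [ m ] ≡ 0
count-[]-≢ m≢n = cong length (filter-reject (_≟ _) {xs = []} m≢n)

count-[]-≡ : ∀ {m n} → m ≡ n → count (λ n → n) n [ m ] ≡ 1
count-[]-≡ m≡n = cong length (filter-accept (_≟ _) {xs = []} m≡n)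

-- Every sum is less than twice the last vertex, which is lo + 1 + size t.
central-far     : ∀ d t → double (suc (size t)) ≤ d → central d t ≡ 0
centralEdge-far : ∀ d t → double (suc (size t)) ≤ d → centralEdge d t ≡ 0
central-far d leaf       far = refl
central-far d (node l r) far = cong₂ _+_
  (centralEdge-far d l (m+n≤o⇒m≤o _ far′))
  (centralEdge-far _ r (m+n≤o⇒m≤o∸n _ (subst (_≤ d) (+-comm (double (suc (size l))) _) far′)))
  where
  far′ : double (suc (size l)) + double (suc (size r)) ≤ d
  far′ = subst (_≤ d) (trans (cong (double ∘ suc) (sym (+-suc (size l) (size r)))) (double-+ (suc (size l)) (suc (size r)))) far
centralEdge-far d leaf         far = refl
centralEdge-far d t@(node l r) far = cong₂ _+_
  (count-[]-≢ {suc (size t)} {d} (<⇒≢ (≤-trans (s≤s (s≤s (n≤double (size t)))) far)))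
  (central-far d t far)

centralEdge-≢ : ∀ {d} t → suc (size t) ≢ d → centralEdge d t ≡ central d t
centralEdge-≢ leaf         ≢d = refl
centralEdge-≢ {d} t@(node _ _) ≢d = cong (_+ central d t) (count-[]-≢ ≢d)

centralEdge-≡ : ∀ {d} t → 0 < size t → suc (size t) ≡ d → centralEdge d t ≡ suc (central d t)
centralEdge-≡ {d} t@(node _ _) _ ≡d = cong (_+ central d t) (count-[]-≡ ≡d)

count-suc-0 : ∀ {A : Set} (v : A → ℕ) xs → count (suc ∘ v) 0 xs ≡ 0
count-suc-0 v xs = cong length (filter-none (λ x → suc (v x) ≟ 0) {xs} (All.universal (λ _ ()) xs))

count-suc-suc : ∀ {A : Set} (v : A → ℕ) k xs → count (suc ∘ v) (suc k) xs ≡ count v k xs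
count-suc-suc v k []       = refl
count-suc-suc v k (x ∷ xs) with does (v x ≟ k)
... | true  = cong suc (count-suc-suc v k xs)
... | false = count-suc-suc v k xs

-- `Y` with its diagonal overwritten by `D`. The recursion on both indices, in place of a test for
-- equality, lets `hat-shift` hold by computation.
hat : Series → (ℕ → ℕ → ℕ) → ℕ → ℕ → ℕ
hat D Y zero    zero    = D 0
hat D Y zero    (suc j) = Y zero (suc j)
hat D Y (suc i) zero    = Y (suc i) zero
hat D Y (suc i) (suc j) = hat (D ∘ suc) (λ i j → Y (suc i) (suc j)) i j

hat-diagonal : ∀ D Y i → hat D Y i i ≡ D i
hat-diagonal D Y zero    = refl
hat-diagonal D Y (suc i) = hat-diagonal (D ∘ suc) (λ i j → Y (suc i) (suc j)) i

hat-off-diagonal : ∀ D Y {i j} → i ≢ j → hat D Y i j ≡ Y i j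
hat-off-diagonal D Y {zero}  {zero}  i≢j = contradiction refl i≢j
hat-off-diagonal D Y {zero}  {suc j} i≢j = refl
hat-off-diagonal D Y {suc i} {zero}  i≢j = refl
hat-off-diagonal D Y {suc i} {suc j} i≢j = hat-off-diagonal (D ∘ suc) (λ i j → Y (suc i) (suc j)) (i≢j ∘ cong suc)

hat-cong : ∀ {D D′ Y Y′} → D ≗ D′ → ∀ i j → Y i j ≡ Y′ i j → hat D Y i j ≡ hat D′ Y′ i j
hat-cong p zero    zero    q = p 0
hat-cong p zero    (suc j) q = q
hat-cong p (suc i) zero    q = q
hat-cong p (suc i) (suc j) q = hat-cong (p ∘ suc) i j q

hat-linear : ∀ r D D′ Y Y′ i j →
             hat (r · D ⊕ D′) (λ i j → r * Y i j + Y′ i j) i j ≡ r * hat D Y i j + hat D′ Y′ i j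
hat-linear r D D′ Y Y′ zero    zero    = refl
hat-linear r D D′ Y Y′ zero    (suc j) = refl
hat-linear r D D′ Y Y′ (suc i) zero    = refl
hat-linear r D D′ Y Y′ (suc i) (suc j) =
  hat-linear r (D ∘ suc) (D′ ∘ suc) (λ i j → Y (suc i) (suc j)) (λ i j → Y′ (suc i) (suc j)) i j

-- Removing the triangle on the root edge, whose ends are at distances x and y from the centre,
-- leaves one part that contains the centre and one part counted by Cat.
-- The root edge of the part with the centre is central when it lies on the diagonal.
step : (B : ℕ → ℕ → ℕ) (D : Series) (Y : ℕ → ℕ → ℕ) → ℕ → ℕ → ℕ
step B D Y x y = B x y + ((Cat ⊛ (λ i → hat D Y i y)) x + ((λ j → hat D Y x j) ⊛ Cat) y)

Solves : (B : ℕ → ℕ → ℕ) (D : Series) (Y : ℕ → ℕ → ℕ) → Set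
Solves B D Y = ∀ x y → Y x y ≡ step B D Y x y

trees-split : ∀ x y {m} → suc m ≡ x + y →
  trees (x + y) ≡ (trees ⊠ (λ j → trees (j + y))) x ++ ((λ j → trees (x + j)) ⊠ trees) y
trees-split x y {m} eq = trans
  (trans (cong trees (sym eq)) (trans (trees-suc m) (cong (trees ⊠ trees) eq)))
  (⊠-split trees trees x y)

-- The left part ends at or before the centre, so `centralEdge-far` applies to it.
central-right : ∀ d e i {l} r → d ≡ double (suc i) + e → l ∈ trees i →
                central d (node l r) ≡ centralEdge e r
central-right d e i {l} r refl l∈ rewrite sym (∈-trees⁻ i l∈) = cong₂ _+_
  (centralEdge-far _ l (m≤m+n (double (suc (size l))) e))
  (cong (λ d → centralEdge d r) (m+n∸m≡n (double (suc (size l))) e))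

-- The right part begins at or after the centre, so the truncated difference is 0.
central-left : ∀ d i {l} r → d ≤ double (suc i) → l ∈ trees i →
               central d (node l r) ≡ centralEdge d l
central-left d i {l} r le l∈ rewrite sym (∈-trees⁻ i l∈) | m≤n⇒m∸n≡0 le | centralEdge-0 r =
  +-identityʳ (centralEdge d l)

-- Around a central side, at distances x and y.
evenCount : ℕ → ℕ → ℕ → ℕ
evenCount k x y = count (central (suc (double x))) k (trees (x + y))

-- Triangulations under a central edge at distance d, with that edge counted. At d = 0 it is the
-- central side, which is not a diagonal and leaves the count at 0.
evenDiagonal : ℕ → Series
evenDiagonal k       zero    = 𝟏 k
evenDiagonal zero    (suc d) = 0
evenDiagonal (suc k) (suc d) = evenCount k (suc d) (suc d)

-- Around a central vertex, at distances 1 + x and 1 + y.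
oddCount : ℕ → ℕ → ℕ → ℕ
oddCount k x y = count (central (double (suc x))) k (trees (suc (x + y)))

-- No exception at d = 0 here: the edge joining the two neighbours of the central vertex is already
-- not a side.
oddDiagonal : ℕ → Series
oddDiagonal zero    d = 0
oddDiagonal (suc k) d = oddCount k d d

x+y≡double⇒x≡y : ∀ x y → x + y ≡ double x → x ≡ y
x+y≡double⇒x≡y x y eq = sym (+-cancelˡ-≡ x y x (trans eq (double≡+ x)))

evenCount-edge : ∀ k x y → count (centralEdge (suc (double x))) k (trees (x + y)) ≡ hat (evenDiagonal k) (evenCount k) x y
evenCount-edge k x y with x ≟ y
... | no x≢y = trans
  (count-cong k (trees (x + y)) λ {t} t∈ → centralEdge-≢ t λ eq →
    x≢y (x+y≡double⇒x≡y x y (trans (sym (∈-trees⁻ (x + y) t∈)) (suc-injective eq))))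
  (sym (hat-off-diagonal (evenDiagonal k) (evenCount k) x≢y))
... | yes refl = trans (diagonal k x) (sym (hat-diagonal (evenDiagonal k) (evenCount k) x))
  where
  root : ∀ k x → count (centralEdge (suc (double (suc x)))) k (trees (suc x + suc x)) ≡
                 count (suc ∘ central (suc (double (suc x)))) k (trees (suc x + suc x))
  root k x = count-cong k (trees (suc x + suc x)) λ {t} t∈ → centralEdge-≡ t
    (subst (0 <_) (sym (∈-trees⁻ (suc x + suc x) t∈)) z<s)
    (cong suc (trans (∈-trees⁻ (suc x + suc x) t∈) (sym (double≡+ (suc x)))))
  diagonal : ∀ k x → count (centralEdge (suc (double x))) k (trees (x + x)) ≡ evenDiagonal k x
  diagonal zero    zero    = refl
  diagonal (suc k) zero    = refl
  diagonal zero    (suc x) = trans (root 0 x) (count-suc-0 (central (suc (double (suc x)))) (trees (suc x + suc x)))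
  diagonal (suc k) (suc x) = trans (root (suc k) x) (count-suc-suc (central (suc (double (suc x)))) k (trees (suc x + suc x)))

-- `e j` is the wanted sum as seen from the first vertex of the right part, of size j + y.
count-trees-split : ∀ k x y d (e : ℕ → ℕ) {m} → suc m ≡ x + y →
  (∀ i j → suc (i + j) ≡ x → d ≡ double (suc i) + e j) → (∀ i → d ≤ double (suc (x + i))) →
  count (central d) k (trees (x + y)) ≡
  (Cat ⊛ (λ j → count (centralEdge (e j)) k (trees (j + y)))) x +
  ((λ i → count (centralEdge d) k (trees (x + i))) ⊛ Cat) y
count-trees-split k x y d e eq right left = begin
  count (central d) k (trees (x + y))
    ≡⟨ cong (count (central d) k) (trees-split x y eq) ⟩
  count (central d) k ((trees ⊠ (λ j → trees (j + y))) x ++ ((λ j → trees (x + j)) ⊠ trees) y)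
    ≡⟨ count-++ (central d) k ((trees ⊠ (λ j → trees (j + y))) x) _ ⟩
  count (central d) k ((trees ⊠ (λ j → trees (j + y))) x) +
  count (central d) k (((λ j → trees (x + j)) ⊠ trees) y)
    ≡⟨ cong₂ _+_
         (count-⊠ʳ (central d) (λ j → centralEdge (e j)) k trees (λ j → trees (j + y)) x
           λ i j i+j {l} {r} l∈ _ → central-right d (e j) i r (right i j i+j) l∈)
         (count-⊠ˡ (central d) (λ _ → centralEdge d) k (λ i → trees (x + i)) trees y
           λ i j _ {l} {r} l∈ _ → central-left d (x + i) r (left i) l∈) ⟩
  (Cat ⊛ (λ j → count (centralEdge (e j)) k (trees (j + y)))) x +
  ((λ i → count (centralEdge d) k (trees (x + i))) ⊛ Cat) y ∎
  where open ≡-Reasoning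

evenCount-split : ∀ k x y {m} → suc m ≡ x + y →
  evenCount k x y ≡ step (λ x y → 𝟏 k * 𝟏 (x + y)) (evenDiagonal k) (evenCount k) x y
evenCount-split k x y {m} eq = begin
  evenCount k x y
    ≡⟨ count-trees-split k x y (suc (double x)) (suc ∘ double) eq
         (λ { i j refl → cong suc (trans (double-+ (suc i) j) (sym (+-suc (suc (double i)) (double j)))) })
         (λ i → s≤s (m≤n⇒m≤1+n (double-mono (m≤m+n x i)))) ⟩
  (Cat ⊛ (λ j → count (centralEdge (suc (double j))) k (trees (j + y)))) x +
  ((λ i → count (centralEdge (suc (double x))) k (trees (x + i))) ⊛ Cat) y
    ≡⟨ cong₂ _+_ (⊛-cong {a = Cat} (λ _ → refl) (λ j → evenCount-edge k j y) x)
                 (⊛-cong {b = Cat} (λ i → evenCount-edge k x i) (λ _ → refl) y) ⟩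
  (Cat ⊛ (λ j → hat (evenDiagonal k) (evenCount k) j y)) x +
  ((λ i → hat (evenDiagonal k) (evenCount k) x i) ⊛ Cat) y
    ≡⟨ cong (_+ ((Cat ⊛ (λ j → hat (evenDiagonal k) (evenCount k) j y)) x + ((λ i → hat (evenDiagonal k) (evenCount k) x i) ⊛ Cat) y))
         (trans (cong (λ s → 𝟏 k * 𝟏 s) (sym eq)) (*-zeroʳ (𝟏 k))) ⟨
  step (λ x y → 𝟏 k * 𝟏 (x + y)) (evenDiagonal k) (evenCount k) x y ∎
  where open ≡-Reasoning

-- The source is a single tree, the leaf at (0, 0), where the polygon has shrunk to the central
-- side.
evenCount-solves : ∀ k → Solves (λ x y → 𝟏 k * 𝟏 (x + y)) (evenDiagonal k) (evenCount k)
evenCount-solves zero    zero zero = refl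
evenCount-solves (suc k) zero zero = refl
evenCount-solves k zero    y@(suc _) = evenCount-split k zero    y refl
evenCount-solves k x@(suc _) y       = evenCount-split k x       y refl

oddCount-edge : ∀ k x y → count (centralEdge (double (suc x))) k (trees (suc (x + y))) ≡ hat (oddDiagonal k) (oddCount k) x y
oddCount-edge k x y with x ≟ y
... | no x≢y = trans
  (count-cong k (trees (suc (x + y))) λ {t} t∈ → centralEdge-≢ t λ eq →
    x≢y (x+y≡double⇒x≡y x y (suc-injective (trans (sym (∈-trees⁻ (suc (x + y)) t∈)) (suc-injective eq)))))
  (sym (hat-off-diagonal (oddDiagonal k) (oddCount k) x≢y))
... | yes refl = trans (diagonal k) (sym (hat-diagonal (oddDiagonal k) (oddCount k) x))
  where
  root : ∀ k → count (centralEdge (double (suc x))) k (trees (suc (x + x))) ≡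
               count (suc ∘ central (double (suc x))) k (trees (suc (x + x)))
  root k = count-cong k (trees (suc (x + x))) λ {t} t∈ → centralEdge-≡ t
    (subst (0 <_) (sym (∈-trees⁻ (suc (x + x)) t∈)) z<s)
    (cong suc (trans (∈-trees⁻ (suc (x + x)) t∈) (cong suc (sym (double≡+ x)))))
  diagonal : ∀ k → count (centralEdge (double (suc x))) k (trees (suc (x + x))) ≡ oddDiagonal k x
  diagonal zero    = trans (root 0) (count-suc-0 (central (double (suc x))) (trees (suc (x + x))))
  diagonal (suc k) = trans (root (suc k)) (count-suc-suc (central (double (suc x))) k (trees (suc (x + x))))

oddCount-solves : ∀ k → Solves (λ x y → 𝟏 k * (Cat x * Cat y)) (oddDiagonal k) (oddCount k)
oddCount-solves k x y = begin
  oddCount k x y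
    ≡⟨ cong (count (central d) k ∘ trees) (+-suc x y) ⟨
  count (central d) k (trees (x + suc y))
    ≡⟨ count-trees-split k x (suc y) d (double ∘ suc) (sym (+-suc x y))
         (λ { i j refl → trans (cong (double ∘ suc) (sym (+-suc i j))) (double-+ (suc i) (suc j)) })
         (λ i → double-mono (s≤s (m≤m+n x i))) ⟩
  (Cat ⊛ (λ j → count (centralEdge (double (suc j))) k (trees (j + suc y)))) x +
  (tip * Cat y + ((λ i → count (centralEdge d) k (trees (x + suc i))) ⊛ Cat) y)
    ≡⟨ cong₂ (λ s t → s + (tip * Cat y + t))
         (⊛-cong {a = Cat} (λ _ → refl) (λ j → trans (cong (count (centralEdge (double (suc j))) k ∘ trees) (+-suc j y)) (oddCount-edge k j y)) x)
         (⊛-cong {b = Cat} (λ i → trans (cong (count (centralEdge d) k ∘ trees) (+-suc x i)) (oddCount-edge k x i)) (λ _ → refl) y) ⟩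
  L + (tip * Cat y + R)
    ≡⟨ cong (λ s → L + (s * Cat y + R)) tip≡ ⟩
  L + (𝟏 k * Cat x * Cat y + R)
    ≡⟨ lemma L (𝟏 k) (Cat x) (Cat y) R ⟩
  step (λ x y → 𝟏 k * (Cat x * Cat y)) (oddDiagonal k) (oddCount k) x y ∎
  where
  open ≡-Reasoning
  d   = double (suc x)
  tip = count (centralEdge d) k (trees (x + 0))
  L   = (Cat ⊛ (λ j → hat (oddDiagonal k) (oddCount k) j y)) x
  R   = ((λ i → hat (oddDiagonal k) (oddCount k) x i) ⊛ Cat) y
  lemma : ∀ l e x y r → l + (e * x * y + r) ≡ e * (x * y) + (l + r)
  lemma = solve-∀
  tip≡ : tip ≡ 𝟏 k * Cat x
  tip≡ = begin
    count (centralEdge d) k (trees (x + 0)) ≡⟨ cong (count (centralEdge d) k ∘ trees) (+-identityʳ x) ⟩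
    count (centralEdge d) k (trees x)       ≡⟨ count-cong k (trees x) (λ {t} t∈ →
                                                 centralEdge-far d t (≤-reflexive (cong (double ∘ suc) (∈-trees⁻ x t∈)))) ⟩
    count (λ _ → 0) k (trees x)             ≡⟨ count-const 0 k (trees x) ⟩
    count (λ n → n) k [ 0 ] * Cat x         ≡⟨ cong (_* Cat x) (unit k) ⟩
    𝟏 k * Cat x                             ∎
    where
    unit : ∀ k → count (λ n → n) k [ 0 ] ≡ 𝟏 k
    unit zero    = refl
    unit (suc k) = refl

-- The linear recurrence and its solution

step-cong : ∀ {B B′ D D′ Y Y′} x y → B x y ≡ B′ x y → D ≗ D′ →
            (∀ i → i < x → Y i y ≡ Y′ i y) → (∀ j → j < y → Y x j ≡ Y′ x j) →
            step B D Y x y ≡ step B′ D′ Y′ x y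
step-cong {D = D} {D′} {Y} {Y′} x y p q r s = cong₂ _+_ p (cong₂ _+_
  (⊛-cong-< {Cat} {Cat} {λ i → hat D Y i y} {λ i → hat D′ Y′ i y} x (λ _ _ → refl) (λ i i<x → hat-cong q i y (r i i<x)))
  (⊛-cong-< {λ j → hat D Y x j} {λ j → hat D′ Y′ x j} {Cat} {Cat} y (λ j j<y → hat-cong q x j (s j j<y)) (λ _ _ → refl)))

solves-unique : ∀ {B D Y Y′} → Solves B D Y → Solves B D Y′ → ∀ x y → Y x y ≡ Y′ x y
solves-unique {B} {D} {Y} {Y′} S S′ x y = go (suc (x + y)) x y ≤-refl
  where
  go : ∀ n x y → x + y < n → Y x y ≡ Y′ x y
  go (suc n) x y (s≤s x+y≤n) = trans (S x y) (trans
    (step-cong {B} {B} {D} {D} {Y} {Y′} x y refl (λ _ → refl)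
      (λ i i<x → go n i y (≤-trans (+-monoˡ-< y i<x) x+y≤n))
      (λ j j<y → go n x j (≤-trans (+-monoʳ-< x j<y) x+y≤n)))
    (sym (S′ x y)))

step-linear : ∀ r B B′ D D′ Y Y′ x y →
  step (λ x y → r * B x y + B′ x y) (r · D ⊕ D′) (λ x y → r * Y x y + Y′ x y) x y ≡
  r * step B D Y x y + step B′ D′ Y′ x y
step-linear r B B′ D D′ Y Y′ x y = begin
  r * B x y + B′ x y + ((Cat ⊛ (λ i → hat (r · D ⊕ D′) rY i y)) x + ((λ j → hat (r · D ⊕ D′) rY x j) ⊛ Cat) y)
    ≡⟨ cong₂ (λ s t → r * B x y + B′ x y + (s + t))
         (⊛-cong {a = Cat} (λ _ → refl) (λ i → hat-linear r D D′ Y Y′ i y) x)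
         (⊛-cong {b = Cat} (λ j → hat-linear r D D′ Y Y′ x j) (λ _ → refl) y) ⟩
  r * B x y + B′ x y + ((Cat ⊛ (r · H ⊕ H′)) x + ((r · K ⊕ K′) ⊛ Cat) y)
    ≡⟨ cong₂ (λ s t → r * B x y + B′ x y + (s + t))
         (trans (⊛-distribˡ Cat (r · H) H′ x) (cong (_+ (Cat ⊛ H′) x) (⊛-·-comm r Cat H x)))
         (trans (⊛-distribʳ (r · K) K′ Cat y) (cong (_+ (K′ ⊛ Cat) y) (·-⊛-assoc r K Cat y))) ⟩
  r * B x y + B′ x y + (r * (Cat ⊛ H) x + (Cat ⊛ H′) x + (r * (K ⊛ Cat) y + (K′ ⊛ Cat) y))
    ≡⟨ lemma r (B x y) (B′ x y) ((Cat ⊛ H) x) ((Cat ⊛ H′) x) ((K ⊛ Cat) y) ((K′ ⊛ Cat) y) ⟩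
  r * step B D Y x y + step B′ D′ Y′ x y ∎
  where
  open ≡-Reasoning
  rY : ℕ → ℕ → ℕ
  rY x y = r * Y x y + Y′ x y
  H H′ K K′ : Series
  H  i = hat D Y i y
  H′ i = hat D′ Y′ i y
  K  j = hat D Y x j
  K′ j = hat D′ Y′ x j
  lemma : ∀ r b b′ h h′ k k′ → r * b + b′ + (r * h + h′ + (r * k + k′)) ≡ r * (b + (h + k)) + (b′ + (h′ + k′))
  lemma = solve-∀

shift : (ℕ → ℕ → ℕ) → ℕ → ℕ → ℕ
shift Y zero    y       = 0
shift Y (suc x) zero    = 0
shift Y (suc x) (suc y) = Y x y

shift-0ʳ : ∀ Y x → shift Y x 0 ≡ 0
shift-0ʳ Y zero    = refl
shift-0ʳ Y (suc x) = refl

𝟎𝟎 : ℕ → ℕ → ℕ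
𝟎𝟎 _ _ = 0

hat-shift : ∀ D Y i j → hat (0 ◂ D) (shift Y) i j ≡ shift (hat D Y) i j
hat-shift D Y zero    zero    = refl
hat-shift D Y zero    (suc j) = refl
hat-shift D Y (suc i) zero    = refl
hat-shift D Y (suc i) (suc j) = refl

-- The coefficients depend on differences of coordinates only, and the zeros that `shift` puts on
-- the axes remove the additional terms of the longer convolutions.
step-shift : ∀ D Y x y → step 𝟎𝟎 (0 ◂ D) (shift Y) x y ≡ shift (step 𝟎𝟎 D Y) x y
step-shift D Y x y = trans
  (cong₂ _+_ (⊛-cong {a = Cat} (λ _ → refl) (λ i → hat-shift D Y i y) x)
             (⊛-cong {b = Cat} (λ j → hat-shift D Y x j) (λ _ → refl) y))
  (go x y)
  where
  go : ∀ x y → (Cat ⊛ (λ i → shift (hat D Y) i y)) x + ((λ j → shift (hat D Y) x j) ⊛ Cat) y ≡ shift (step 𝟎𝟎 D Y) x y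
  go zero    y       = ⊛-zeroˡ Cat y
  go (suc x) zero    = trans (+-identityʳ _)
    (trans (⊛-cong {a = Cat} (λ _ → refl) (shift-0ʳ (hat D Y)) (suc x)) (⊛-zeroʳ Cat (suc x)))
  go (suc x) (suc y) = cong (_+ ((λ j → hat D Y x j) ⊛ Cat) y)
    (trans (⊛-last Cat (λ i → shift (hat D Y) i (suc y)) x)
           (cong (_+ (Cat ⊛ (λ i → hat D Y i y)) x) (*-zeroʳ (Cat x))))

-- It agrees with `evenCount 0` except at (0, 0), where it is 0 instead of 1: staying at a point is
-- not a return to it.
firstReturn : ℕ → ℕ → ℕ
firstReturn = step 𝟎𝟎 𝟏 (evenCount 0)

evenDiagonal-0 : evenDiagonal 0 ≗ 𝟏
evenDiagonal-0 zero    = refl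
evenDiagonal-0 (suc d) = refl

firstReturn-solves : Solves 𝟎𝟎 𝟏 firstReturn
firstReturn-solves x y = cong₂ _+_
  (⊛-cong {a = Cat} (λ _ → refl) (λ i → eq i y) x) (⊛-cong {b = Cat} (eq x) (λ _ → refl) y)
  where
  off : ∀ i j → i + j ≢ 0 → evenCount 0 i j ≡ firstReturn i j
  off i j i+j≢0 = trans (evenCount-solves 0 i j)
    (step-cong {λ x y → 𝟏 0 * 𝟏 (x + y)} {𝟎𝟎} {evenDiagonal 0} {𝟏} {evenCount 0} {evenCount 0} i j
      (unit (i + j) i+j≢0) evenDiagonal-0 (λ _ _ → refl) (λ _ _ → refl))
    where
    unit : ∀ n → n ≢ 0 → 𝟏 0 * 𝟏 n ≡ 0
    unit zero    n≢0 with () ← n≢0 refl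
    unit (suc n) n≢0 = refl
  eq : ∀ i j → hat 𝟏 (evenCount 0) i j ≡ hat 𝟏 firstReturn i j
  eq zero    zero    = refl
  eq zero    (suc j) = off zero (suc j) λ ()
  eq (suc i) zero    = off (suc i) zero λ ()
  eq (suc i) (suc j) = hat-cong (λ _ → refl) i j (off (suc i) (suc j) λ ())

-- Σ_d D d * firstReturn (x - d) (y - d), where d is the distance from the centre of the central
-- edge nearest to the root.
viaDiagonal : Series → ℕ → ℕ → ℕ
viaDiagonal D zero    y       = D 0 * firstReturn 0 y
viaDiagonal D (suc x) zero    = D 0 * firstReturn (suc x) 0
viaDiagonal D (suc x) (suc y) = D 0 * firstReturn (suc x) (suc y) + viaDiagonal (D ∘ suc) x y

viaDiagonal-shift : ∀ D x y → viaDiagonal D x y ≡ D 0 * firstReturn x y + shift (viaDiagonal (D ∘ suc)) x y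
viaDiagonal-shift D zero    y       = sym (+-identityʳ _)
viaDiagonal-shift D (suc x) zero    = sym (+-identityʳ _)
viaDiagonal-shift D (suc x) (suc y) = refl

-- Superposition of `firstReturn`, weighted by `D 0`, and of the translated solution for the tail of
-- `D`.
viaDiagonal-solves : ∀ D → Solves 𝟎𝟎 D (viaDiagonal D)
viaDiagonal-solves D x y = begin
  viaDiagonal D x y
    ≡⟨ viaDiagonal-shift D x y ⟩
  D 0 * firstReturn x y + shift (viaDiagonal (D ∘ suc)) x y
    ≡⟨ cong₂ (λ s t → D 0 * s + t) (firstReturn-solves x y)
         (trans (shifted x y) (sym (step-shift (D ∘ suc) (viaDiagonal (D ∘ suc)) x y))) ⟩
  D 0 * step 𝟎𝟎 𝟏 firstReturn x y + step 𝟎𝟎 (0 ◂ D ∘ suc) (shift (viaDiagonal (D ∘ suc))) x y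
    ≡⟨ step-linear (D 0) 𝟎𝟎 𝟎𝟎 𝟏 (0 ◂ D ∘ suc) firstReturn (shift (viaDiagonal (D ∘ suc))) x y ⟨
  step (λ x y → D 0 * 0 + 0) (D 0 · 𝟏 ⊕ (0 ◂ D ∘ suc)) (λ x y → D 0 * firstReturn x y + shift (viaDiagonal (D ∘ suc)) x y) x y
    ≡⟨ step-cong {λ x y → D 0 * 0 + 0} {𝟎𝟎} {D 0 · 𝟏 ⊕ (0 ◂ D ∘ suc)} {D}
         {λ x y → D 0 * firstReturn x y + shift (viaDiagonal (D ∘ suc)) x y} {viaDiagonal D} x y
         (trans (+-identityʳ _) (*-zeroʳ (D 0))) split
         (λ i _ → sym (viaDiagonal-shift D i y)) (λ j _ → sym (viaDiagonal-shift D x j)) ⟩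
  step 𝟎𝟎 D (viaDiagonal D) x y ∎
  where
  open ≡-Reasoning
  shifted : ∀ x y → shift (viaDiagonal (D ∘ suc)) x y ≡ shift (step 𝟎𝟎 (D ∘ suc) (viaDiagonal (D ∘ suc))) x y
  shifted zero    y       = refl
  shifted (suc x) zero    = refl
  shifted (suc x) (suc y) = viaDiagonal-solves (D ∘ suc) x y
  split : D 0 · 𝟏 ⊕ (0 ◂ D ∘ suc) ≗ D
  split zero    = trans (+-identityʳ _) (*-identityʳ (D 0))
  split (suc n) = cong (_+ D (suc n)) (*-zeroʳ (D 0))

-- By linearity and uniqueness: `Y₀` takes up the source and is absorbed on the diagonal, while
-- `viaDiagonal D` starts afresh from the values prescribed there.
solution : ∀ {B D Y Y₀} → Solves B D Y → Solves B 𝟎 Y₀ → ∀ x y → Y x y ≡ Y₀ x y + viaDiagonal D x y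
solution {B} {D} {Y} {Y₀} S S₀ = solves-unique {B} {D} S λ x y → begin
  Y₀ x y + viaDiagonal D x y
    ≡⟨ cong₂ _+_ (trans (S₀ x y) (sym (*-identityˡ (step B 𝟎 Y₀ x y)))) (viaDiagonal-solves D x y) ⟩
  1 * step B 𝟎 Y₀ x y + step 𝟎𝟎 D (viaDiagonal D) x y
    ≡⟨ step-linear 1 B 𝟎𝟎 𝟎 D Y₀ (viaDiagonal D) x y ⟨
  step (λ x y → 1 * B x y + 0) (1 · 𝟎 ⊕ D) (λ x y → 1 * Y₀ x y + viaDiagonal D x y) x y
    ≡⟨ step-cong {λ x y → 1 * B x y + 0} {B} {1 · 𝟎 ⊕ D} {D}
         {λ x y → 1 * Y₀ x y + viaDiagonal D x y} {λ x y → Y₀ x y + viaDiagonal D x y} x y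
         (trans (+-identityʳ _) (*-identityˡ (B x y))) (λ _ → refl)
         (λ i _ → cong (_+ viaDiagonal D i y) (*-identityˡ (Y₀ i y)))
         (λ j _ → cong (_+ viaDiagonal D x j) (*-identityˡ (Y₀ x j))) ⟩
  step B D (λ x y → Y₀ x y + viaDiagonal D x y) x y ∎
  where open ≡-Reasoning

hat-own-diagonal : ∀ Y i j → hat (λ d → Y d d) Y i j ≡ Y i j
hat-own-diagonal Y zero    zero    = refl
hat-own-diagonal Y zero    (suc j) = refl
hat-own-diagonal Y (suc i) zero    = refl
hat-own-diagonal Y (suc i) (suc j) = hat-own-diagonal (λ i j → Y (suc i) (suc j)) i j

-- When k is disregarded, crossing the diagonal changes nothing; this brings a plain convolution
-- recurrence into the common form.
solves-own-diagonal : ∀ {B} Y →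
  (∀ x y → Y x y ≡ B x y + ((Cat ⊛ (λ i → Y i y)) x + ((λ j → Y x j) ⊛ Cat) y)) →
  Solves B (λ d → Y d d) Y
solves-own-diagonal {B} Y eq x y = trans (eq x y) (cong₂ (λ s t → B x y + (s + t))
  (⊛-cong {a = Cat} (λ _ → refl) (λ i → sym (hat-own-diagonal Y i y)) x)
  (⊛-cong {b = Cat} (λ j → sym (hat-own-diagonal Y x j)) (λ _ → refl) y))

hat-𝟎 : ∀ {Y} → (∀ x y → x ≢ y → Y x y ≡ 0) → ∀ i j → hat 𝟎 Y i j ≡ 0
hat-𝟎 {Y} Y≡0 i j with i ≟ j
... | yes refl = hat-diagonal 𝟎 Y i
... | no  i≢j  = trans (hat-off-diagonal 𝟎 Y i≢j) (Y≡0 i j i≢j)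

-- A source living on the diagonal is invisible to all other points once the diagonal is overwritten
-- by 0.
solves-𝟎 : ∀ Y → (∀ x y → x ≢ y → Y x y ≡ 0) → Solves Y 𝟎 Y
solves-𝟎 Y Y≡0 x y = sym (trans
  (cong (Y x y +_) (cong₂ _+_
    (trans (⊛-cong {a = Cat} (λ _ → refl) (λ i → hat-𝟎 Y≡0 i y) x) (⊛-zeroʳ Cat x))
    (trans (⊛-cong {b = Cat} (λ j → hat-𝟎 Y≡0 x j) (λ _ → refl) y) (⊛-zeroˡ Cat y))))
  (+-identityʳ (Y x y)))

-- C_{2d} counts everything under the central edge nearest to the root, the central side being the
-- case d = 0. Only the leaf at x = y = 0 is left over, giving `𝟏`.
Cat-even-total : ∀ x y → Cat (x + y) ≡ 𝟏 (x + y) + viaDiagonal (λ d → Cat (d + d)) x y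
Cat-even-total = solution {λ x y → 𝟏 (x + y)}
  (solves-own-diagonal {λ x y → 𝟏 (x + y)} (λ x y → Cat (x + y)) λ x y → trans (Cat≡ (x + y)) (cong (𝟏 (x + y) +_) (⊛-split Cat Cat x y)))
  (solves-𝟎 (λ x y → 𝟏 (x + y)) 𝟏-off)
  where
  Cat≡ : ∀ n → Cat n ≡ 𝟏 n + (Cat ⊛ Cat) n
  Cat≡ zero    = refl
  Cat≡ (suc n) = Cat-suc n
  𝟏-off : ∀ x y → x ≢ y → 𝟏 (x + y) ≡ 0
  𝟏-off zero    zero    x≢y = contradiction refl x≢y
  𝟏-off zero    (suc y) x≢y = refl
  𝟏-off (suc x) y       x≢y = refl

-- Around a vertex there may be no central edge below the root at all; these trees form the summand
-- `oddCount 0`.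
Cat-odd-total : ∀ x y → Cat (suc (x + y)) ≡ oddCount 0 x y + viaDiagonal (λ d → Cat (suc (d + d))) x y
Cat-odd-total = solution {λ x y → 𝟏 0 * (Cat x * Cat y)}
  (solves-own-diagonal {λ x y → 𝟏 0 * (Cat x * Cat y)} (λ x y → Cat (suc (x + y))) eq)
  (oddCount-solves 0)
  where
  open ≡-Reasoning
  lemma : ∀ l x y r → l + (x * y + r) ≡ 1 * (x * y) + (l + r)
  lemma = solve-∀
  eq : ∀ x y → Cat (suc (x + y)) ≡
       𝟏 0 * (Cat x * Cat y) + ((Cat ⊛ (λ i → Cat (suc (i + y)))) x + ((λ j → Cat (suc (x + j))) ⊛ Cat) y)
  eq x y = begin
    Cat (suc (x + y))
      ≡⟨ trans (Cat-suc (x + y)) (cong (Cat ⊛ Cat) (sym (+-suc x y))) ⟩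
    (Cat ⊛ Cat) (x + suc y)
      ≡⟨ ⊛-split Cat Cat x (suc y) ⟩
    (Cat ⊛ (λ i → Cat (i + suc y))) x + (Cat (x + 0) * Cat y + ((λ j → Cat (x + suc j)) ⊛ Cat) y)
      ≡⟨ cong₂ _+_ (⊛-cong {a = Cat} (λ _ → refl) (λ i → cong Cat (+-suc i y)) x)
           (cong₂ _+_ (cong (λ s → Cat s * Cat y) (+-identityʳ x)) (⊛-cong {b = Cat} (λ j → cong Cat (+-suc x j)) (λ _ → refl) y)) ⟩
    (Cat ⊛ (λ i → Cat (suc (i + y)))) x + (Cat x * Cat y + ((λ j → Cat (suc (x + j))) ⊛ Cat) y)
      ≡⟨ lemma ((Cat ⊛ (λ i → Cat (suc (i + y)))) x) (Cat x) (Cat y) (((λ j → Cat (suc (x + j))) ⊛ Cat) y) ⟩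
    _ ∎

-- First returns in terms of Catalan numbers

returns nearReturns : Series
returns     n = firstReturn n n
nearReturns n = firstReturn (suc n) n

viaDiagonal-diagonal : ∀ D n → viaDiagonal D n n ≡ (D ⋆ returns) n
viaDiagonal-diagonal D zero    = sym (+-identityʳ _)
viaDiagonal-diagonal D (suc n) = cong (D 0 * firstReturn (suc n) (suc n) +_) (viaDiagonal-diagonal (D ∘ suc) n)

viaDiagonal-near : ∀ D n → viaDiagonal D (suc n) n ≡ (D ⋆ nearReturns) n
viaDiagonal-near D zero    = sym (+-identityʳ _)
viaDiagonal-near D (suc n) = cong (D 0 * firstReturn (suc (suc n)) (suc n) +_) (viaDiagonal-near (D ∘ suc) n)

catEven catOdd : Series
catEven = evens Cat
catOdd  = odds Cat

catEven≡ : ∀ n → Cat (n + n) ≡ catEven n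
catEven≡ n = cong Cat (sym (double≡+ n))

catOdd≡ : ∀ n → Cat (suc (n + n)) ≡ catOdd n
catOdd≡ n = cong (Cat ∘ suc) (sym (double≡+ n))

catEven-rec : catEven ≗ 𝟏 ⊕ 2 · (catOdd ⊛ catEven)
catEven-rec zero    = refl
catEven-rec (suc n) = begin
  Cat (double (suc n))                    ≡⟨ Cat-suc (suc (double n)) ⟩
  (Cat ⊛ Cat) (double (suc n))            ≡⟨ ⊛-evens Cat Cat (suc n) ⟩
  (catEven ⊛ catOdd) (suc n) + (catOdd ⊛ catEven) (suc n)
    ≡⟨ cong₂ _+_ (⊛-comm catEven catOdd (suc n)) (sym (+-identityʳ _)) ⟩
  2 * (catOdd ⊛ catEven) (suc n)          ∎
  where open ≡-Reasoning

catOdd-rec : catOdd ≗ (catEven ⋆ catEven) ⊕ (catOdd ⊛ catOdd)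
catOdd-rec n = trans (Cat-suc (double n)) (⊛-odds Cat Cat n)

-- With g = `catEven`, o = `catOdd` and R = `returns`, the central edge nearest to the root gives g
-- = 1 + g R and the parity of the left subtree gives g = 1 + 2 X o g. Cancelling g leaves R = 2 X
-- o.
returns≡ : returns ≗ 0 ◂ 2 · catOdd
returns≡ zero    = refl
returns≡ (suc n) = ⊛-cancelʳ {returns ∘ suc} {2 · catOdd} catEven refl eq n
  where
  open ≡-Reasoning
  eq : (returns ∘ suc ⊛ catEven) ≗ (2 · catOdd ⊛ catEven)
  eq m = +-cancelˡ-≡ (𝟏 m) _ _ (begin
    𝟏 m + (returns ⋆ catEven) m
      ≡⟨ cong (𝟏 m +_) (⊛-comm returns catEven (suc m)) ⟩
    𝟏 m + (catEven ⋆ returns) m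
      ≡⟨ cong₂ _+_ (𝟏-double m) (trans (viaDiagonal-diagonal _ m) (⊛-cong {b = returns} catEven≡ (λ _ → refl) (suc m))) ⟨
    𝟏 (m + m) + viaDiagonal (λ d → Cat (d + d)) m m
      ≡⟨ Cat-even-total m m ⟨
    Cat (m + m)
      ≡⟨ trans (catEven≡ m) (catEven-rec m) ⟩
    𝟏 m + 2 * (catOdd ⊛ catEven) m
      ≡⟨ cong (𝟏 m +_) (·-⊛-assoc 2 catOdd catEven m) ⟨
    𝟏 m + (2 · catOdd ⊛ catEven) m ∎)
    where
    𝟏-double : ∀ m → 𝟏 (m + m) ≡ 𝟏 m
    𝟏-double zero    = refl
    𝟏-double (suc m) = refl

⋆-returns : ∀ D → (D ⋆ returns) ≗ 2 · (catOdd ⊛ D)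
⋆-returns D n = begin
  (D ⋆ returns) n                      ≡⟨ ⊛-comm D returns (suc n) ⟩
  0 * D n + (returns ∘ suc ⊛ D) n      ≡⟨ ⊛-cong {b = D} (returns≡ ∘ suc) (λ _ → refl) n ⟩
  (2 · catOdd ⊛ D) n                   ≡⟨ ·-⊛-assoc 2 catOdd D n ⟩
  2 * (catOdd ⊛ D) n                   ∎
  where open ≡-Reasoning

-- Triangulations of a polygon with 2n + 3 vertices without a diagonal parallel to a given side.
avoiding : Series
avoiding n = oddCount 0 n n

avoiding-rec : catOdd ≗ avoiding ⊕ 2 · (catOdd ⊛ catOdd)
avoiding-rec n = begin
  catOdd n                                                ≡⟨ catOdd≡ n ⟨
  Cat (suc (n + n))                                       ≡⟨ Cat-odd-total n n ⟩
  avoiding n + viaDiagonal (λ d → Cat (suc (d + d))) n n  ≡⟨ cong (avoiding n +_) (viaDiagonal-diagonal _ n) ⟩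
  avoiding n + ((λ d → Cat (suc (d + d))) ⋆ returns) n    ≡⟨ cong (avoiding n +_) (⊛-cong {b = returns} catOdd≡ (λ _ → refl) (suc n)) ⟩
  avoiding n + (catOdd ⋆ returns) n                       ≡⟨ cong (avoiding n +_) (⋆-returns catOdd n) ⟩
  avoiding n + 2 * (catOdd ⊛ catOdd) n                    ∎
  where open ≡-Reasoning

module Solve = SemiringSolver seriesSemiring

-- With g = catEven, o = catOdd, h = avoiding and v = 2 X o g, the recurrences read g = 1 + v and
-- o = h + 2 X o², so that h g + o v = o g = o + o v.
avoiding⋆catEven : (avoiding ⋆ catEven) ≗ catOdd
avoiding⋆catEven n = +-cancelʳ-≡ ((catOdd ⋆ v) n) _ _ (begin
  (h ⋆ g) n + (o ⋆ v) n                        ≡⟨ lemma₁ h g o X n ⟩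
  ((h ⊕ (X ⋆ (o ⋆ o) ⊕ X ⋆ (o ⋆ o))) ⋆ g) n    ≡⟨ ⊛-cong {b = g} (λ m → sym (o-rec m)) (λ _ → refl) (suc n) ⟩
  (o ⋆ g) n                                    ≡⟨ ⊛-cong {a = o} (λ _ → refl) g-rec (suc n) ⟩
  (o ⋆ (𝟏 ⊕ v)) n                              ≡⟨ lemma₂ o v n ⟩
  o n + (o ⋆ v) n                              ∎)
  where
  open ≡-Reasoning
  h = avoiding
  g = catEven
  o = catOdd
  v = X ⋆ (o ⋆ g) ⊕ X ⋆ (o ⋆ g)
  g-rec : g ≗ 𝟏 ⊕ v
  g-rec m = trans (catEven-rec m) (cong (𝟏 m +_) (cong₂ _+_ (sym (X⋆⋆ o g m)) (trans (+-identityʳ _) (sym (X⋆⋆ o g m)))))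
  o-rec : o ≗ h ⊕ (X ⋆ (o ⋆ o) ⊕ X ⋆ (o ⋆ o))
  o-rec m = trans (avoiding-rec m) (cong (h m +_) (cong₂ _+_ (sym (X⋆⋆ o o m)) (trans (+-identityʳ _) (sym (X⋆⋆ o o m)))))
  open Solve
  lemma₁ : ∀ h g o x → (h ⋆ g) ⊕ (o ⋆ (x ⋆ (o ⋆ g) ⊕ x ⋆ (o ⋆ g))) ≗ ((h ⊕ (x ⋆ (o ⋆ o) ⊕ x ⋆ (o ⋆ o))) ⋆ g)
  lemma₁ = solve 4 (λ h g o x → (h :* g) :+ (o :* (x :* (o :* g) :+ x :* (o :* g))) :=
                                (h :+ (x :* (o :* o) :+ x :* (o :* o))) :* g) (λ _ → refl)
  lemma₂ : ∀ o v → (o ⋆ (𝟏 ⊕ v)) ≗ o ⊕ (o ⋆ v)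
  lemma₂ = solve 2 (λ o v → o :* (con 1 :+ v) := o :+ o :* v) (λ _ → refl)

-- Both series have product `catOdd` with `catEven`: this one by `Cat-even-total` beside the
-- diagonal, where its source vanishes. Hence the two special factors in (ii) are the same.
nearReturns≡ : nearReturns ≗ avoiding
nearReturns≡ = ⊛-cancelʳ catEven refl eq
  where
  open ≡-Reasoning
  eq : (nearReturns ⊛ catEven) ≗ (avoiding ⊛ catEven)
  eq zero    = refl
  eq (suc n) = begin
    (nearReturns ⋆ catEven) n               ≡⟨ ⊛-comm nearReturns catEven (suc n) ⟩
    (catEven ⋆ nearReturns) n               ≡⟨ ⊛-cong {b = nearReturns} catEven≡ (λ _ → refl) (suc n) ⟨
    ((λ d → Cat (d + d)) ⋆ nearReturns) n   ≡⟨ viaDiagonal-near (λ d → Cat (d + d)) n ⟨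
    viaDiagonal (λ d → Cat (d + d)) (suc n) n ≡⟨ Cat-even-total (suc n) n ⟨
    Cat (suc (n + n))                       ≡⟨ catOdd≡ n ⟩
    catOdd n                                ≡⟨ avoiding⋆catEven n ⟨
    (avoiding ⋆ catEven) n                  ∎

-- The k-th power of O = X · `catOdd`; the factor X in each `⊛` corresponds to the parts of a
-- composition being at least 1.
powers : ℕ → Series
powers zero    = 𝟏
powers (suc k) = catOdd ⊛ powers k

evenCount-suc : ∀ k x y → evenCount (suc k) x y ≡ viaDiagonal (evenDiagonal (suc k)) x y
evenCount-suc k = solution {𝟎𝟎} (evenCount-solves (suc k)) (solves-𝟎 𝟎𝟎 λ _ _ _ → refl)

oddCount-suc : ∀ k x y → oddCount (suc k) x y ≡ viaDiagonal (oddDiagonal (suc k)) x y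
oddCount-suc k = solution {𝟎𝟎} (oddCount-solves (suc k)) (solves-𝟎 𝟎𝟎 λ _ _ _ → refl)

-- Starting from the central side, each of the k central edges closes one return, that is, a factor
-- 2 O.
evenDiagonal≡ : ∀ k → evenDiagonal k ≗ (2 ^ k) · powers k
evenDiagonal≡ zero zero    = refl
evenDiagonal≡ zero (suc n) = refl
evenDiagonal≡ (suc k) n = begin
  evenDiagonal (suc k) n                 ≡⟨ evenDiagonal-suc k n ⟩
  (evenDiagonal k ⋆ returns) n           ≡⟨ ⊛-cong {b = returns} (evenDiagonal≡ k) (λ _ → refl) (suc n) ⟩
  ((2 ^ k) · powers k ⋆ returns) n       ≡⟨ ·-⊛-assoc (2 ^ k) (powers k) returns (suc n) ⟩
  2 ^ k * (powers k ⋆ returns) n         ≡⟨ cong (2 ^ k *_) (⋆-returns (powers k) n) ⟩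
  2 ^ k * (2 * powers (suc k) n)         ≡⟨ lemma (2 ^ k) (powers (suc k) n) ⟩
  2 ^ suc k * powers (suc k) n           ∎
  where
  open ≡-Reasoning
  lemma : ∀ p w → p * (2 * w) ≡ 2 * p * w
  lemma = solve-∀
  evenDiagonal-suc : ∀ k n → evenDiagonal (suc k) n ≡ (evenDiagonal k ⋆ returns) n
  evenDiagonal-suc zero    zero    = refl
  evenDiagonal-suc (suc k) zero    = refl
  -- The source is gone away from the origin, so `evenCount 0` is `firstReturn` there.
  evenDiagonal-suc zero    (suc n) = begin
    evenCount 0 (suc n) (suc n)          ≡⟨ evenCount-solves 0 (suc n) (suc n) ⟩
    step (λ x y → 𝟏 0 * 𝟏 (x + y)) (evenDiagonal 0) (evenCount 0) (suc n) (suc n)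
      ≡⟨ step-cong {λ x y → 𝟏 0 * 𝟏 (x + y)} {𝟎𝟎} {evenDiagonal 0} {𝟏} {evenCount 0} {evenCount 0} (suc n) (suc n) refl evenDiagonal-0 (λ _ _ → refl) (λ _ _ → refl) ⟩
    returns (suc n)                      ≡⟨ ⊛-identityˡ returns (suc (suc n)) ⟨
    (𝟏 ⋆ returns) (suc n)                ≡⟨ ⊛-cong {b = returns} evenDiagonal-0 (λ _ → refl) (suc (suc n)) ⟨
    (evenDiagonal 0 ⋆ returns) (suc n)   ∎
  evenDiagonal-suc (suc k) (suc n) =
    trans (evenCount-suc k (suc n) (suc n)) (viaDiagonal-diagonal (evenDiagonal (suc k)) (suc n))

-- The region between the central vertex and the first edge on the line x = y gives `avoiding`. The
-- root edge is on this line too, so k central edges below it leave k returns.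
oddDiagonal≡ : ∀ k n → oddCount k n n ≡ 2 ^ k * (avoiding ⋆ powers k) n
oddDiagonal≡ zero    n = sym (trans (+-identityʳ _) (trans (⊛-comm avoiding 𝟏 (suc n)) (⊛-identityˡ avoiding (suc n))))
oddDiagonal≡ (suc k) n = begin
  oddCount (suc k) n n                                   ≡⟨ trans (oddCount-suc k n n) (viaDiagonal-diagonal (oddDiagonal (suc k)) n) ⟩
  (oddDiagonal (suc k) ⋆ returns) n                      ≡⟨ ⊛-cong {b = returns} (oddDiagonal≡ k) (λ _ → refl) (suc n) ⟩
  ((2 ^ k) · (avoiding ⋆ powers k) ⋆ returns) n          ≡⟨ ·-⊛-assoc (2 ^ k) (avoiding ⋆ powers k) returns (suc n) ⟩
  2 ^ k * ((avoiding ⋆ powers k) ⋆ returns) n            ≡⟨ cong (2 ^ k *_) (⋆-returns (avoiding ⋆ powers k) n) ⟩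
  2 ^ k * (2 * (catOdd ⊛ (avoiding ⋆ powers k)) n)       ≡⟨ cong (λ s → 2 ^ k * (2 * s)) swap ⟩
  2 ^ k * (2 * (avoiding ⋆ powers (suc k)) n)            ≡⟨ lemma (2 ^ k) ((avoiding ⋆ powers (suc k)) n) ⟩
  2 ^ suc k * (avoiding ⋆ powers (suc k)) n              ∎
  where
  open ≡-Reasoning
  lemma : ∀ p w → p * (2 * w) ≡ 2 * p * w
  lemma = solve-∀
  open Solve
  swap : (catOdd ⊛ (avoiding ⋆ powers k)) n ≡ (avoiding ⋆ powers (suc k)) n
  swap = begin
    (catOdd ⊛ (avoiding ⋆ powers k)) n         ≡⟨ X⋆⋆ catOdd (avoiding ⋆ powers k) n ⟨
    (X ⋆ (catOdd ⋆ (avoiding ⋆ powers k))) n   ≡⟨ solve 4 (λ x o h w → x :* (o :* (h :* w)) := h :* (x :* (o :* w))) (λ _ → refl) X catOdd avoiding (powers k) n ⟩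
    (avoiding ⋆ (X ⋆ (catOdd ⋆ powers k))) n   ≡⟨ ⊛-cong {a = avoiding} (λ _ → refl) (X⋆⋆ catOdd (powers k)) (suc n) ⟩
    (avoiding ⋆ powers (suc k)) n              ∎

-- The innermost of the k + 1 central edges gives one factor `avoiding`, the k passages between
-- consecutive ones give returns, and the passage from the outermost one to the root, off the line,
-- gives the other `avoiding`.
oddCount-near : ∀ k n → oddCount (suc k) (suc n) n ≡ 2 ^ k * (avoiding ⋆ (avoiding ⋆ powers k)) n
oddCount-near k n = begin
  oddCount (suc k) (suc n) n                             ≡⟨ trans (oddCount-suc k (suc n) n) (viaDiagonal-near (oddDiagonal (suc k)) n) ⟩
  (oddDiagonal (suc k) ⋆ nearReturns) n                  ≡⟨ ⊛-cong (oddDiagonal≡ k) nearReturns≡ (suc n) ⟩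
  ((2 ^ k) · (avoiding ⋆ powers k) ⋆ avoiding) n         ≡⟨ ·-⊛-assoc (2 ^ k) (avoiding ⋆ powers k) avoiding (suc n) ⟩
  2 ^ k * ((avoiding ⋆ powers k) ⋆ avoiding) n           ≡⟨ cong (2 ^ k *_) (⊛-comm (avoiding ⋆ powers k) avoiding (suc n)) ⟩
  2 ^ k * (avoiding ⋆ (avoiding ⋆ powers k)) n           ∎
  where open ≡-Reasoning

-- Shapiro's identity and a closed form for `avoiding`

⊛-scale : ∀ r a b n → ((λ i → r ^ i * a i) ⋆ (λ j → r ^ j * b j)) n ≡ r ^ n * (a ⋆ b) n
⊛-scale r a b zero    = lemma (a 0) (b 0)
  where
  lemma : ∀ x y → 1 * x * (1 * y) + 0 ≡ 1 * (x * y + 0)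
  lemma = solve-∀
⊛-scale r a b (suc n) = begin
  1 * a 0 * (r ^ suc n * b (suc n)) + ((λ i → r ^ suc i * a (suc i)) ⋆ scaled b) n
    ≡⟨ cong (1 * a 0 * (r ^ suc n * b (suc n)) +_)
         (trans (⊛-cong {b = scaled b} (λ i → *-assoc r (r ^ i) (a (suc i))) (λ _ → refl) (suc n))
         (trans (·-⊛-assoc r (scaled (a ∘ suc)) (scaled b) (suc n)) (cong (r *_) (⊛-scale r (a ∘ suc) b n)))) ⟩
  1 * a 0 * (r ^ suc n * b (suc n)) + r * (r ^ n * (a ∘ suc ⋆ b) n)
    ≡⟨ lemma (a 0) r (r ^ n) (b (suc n)) ((a ∘ suc ⋆ b) n) ⟩
  r ^ suc n * (a ⋆ b) (suc n) ∎
  where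
  open ≡-Reasoning
  scaled : Series → Series
  scaled c i = r ^ i * c i
  lemma : ∀ x r p y z → 1 * x * (r * p * y) + r * (p * z) ≡ r * p * (x * y + z)
  lemma = solve-∀

-- Coefficient n of `s ⊛ s` involves only coefficients of `s` below n.
quadratic-unique : ∀ r {s t} → s ≗ 𝟏 ⊕ r · (s ⊛ s) → t ≗ 𝟏 ⊕ r · (t ⊛ t) → s ≗ t
quadratic-unique r {s} {t} s-rec t-rec = <-rec _ λ n eq → trans (s-rec n) (trans
  (cong (λ z → 𝟏 n + r * z) (⊛-cong-< n (λ _ i<n → eq i<n) (λ _ i<n → eq i<n)))
  (sym (t-rec n)))

-- Both sides solve s = 1 + 4 X s².  For the left one, put g = catEven, o = catOdd and v = 2 X o g;
-- then g = 1 + v and o = g² + X o² give g² + v² = 1 + 2 g v = 1 + 4 X g² o = 1 + 4 X g⁴ + v².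
shapiro : ∀ n → (catEven ⋆ catEven) n ≡ 4 ^ n * Cat n
shapiro = quadratic-unique 4 left right
  where
  open ≡-Reasoning
  right : ∀ n → 4 ^ n * Cat n ≡ 𝟏 n + 4 * ((λ i → 4 ^ i * Cat i) ⊛ (λ i → 4 ^ i * Cat i)) n
  right zero    = refl
  right (suc n) = begin
    4 * 4 ^ n * Cat (suc n)       ≡⟨ *-assoc 4 (4 ^ n) (Cat (suc n)) ⟩
    4 * (4 ^ n * Cat (suc n))     ≡⟨ cong (λ z → 4 * (4 ^ n * z)) (Cat-suc n) ⟩
    4 * (4 ^ n * (Cat ⋆ Cat) n)   ≡⟨ cong (4 *_) (⊛-scale 4 Cat Cat n) ⟨
    4 * ((λ i → 4 ^ i * Cat i) ⋆ (λ i → 4 ^ i * Cat i)) n ∎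
  g = catEven
  o = catOdd
  v = X ⋆ (o ⋆ g) ⊕ X ⋆ (o ⋆ g)
  s = g ⋆ g
  g-rec : g ≗ 𝟏 ⊕ v
  g-rec m = trans (catEven-rec m) (cong (𝟏 m +_) (cong₂ _+_ (sym (X⋆⋆ o g m)) (trans (+-identityʳ _) (sym (X⋆⋆ o g m)))))
  o-rec : o ≗ s ⊕ X ⋆ (o ⋆ o)
  o-rec m = trans (catOdd-rec m) (cong (s m +_) (sym (X⋆⋆ o o m)))
  open Solve
  two four : ∀ {n} → Polynomial n → Polynomial n
  two  p = p :+ p
  four p = two (two p)
  left : s ≗ 𝟏 ⊕ 4 · (s ⊛ s)
  left n = +-cancelʳ-≡ ((v ⋆ v) n) _ _ (begin
    (g ⋆ g) n + (v ⋆ v) n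
      ≡⟨ cong (_+ (v ⋆ v) n) (⊛-cong g-rec g-rec (suc n)) ⟩
    ((𝟏 ⊕ v) ⋆ (𝟏 ⊕ v)) n + (v ⋆ v) n
      ≡⟨ solve 1 (λ v → (con 1 :+ v) :* (con 1 :+ v) :+ v :* v := con 1 :+ two ((con 1 :+ v) :* v)) (λ _ → refl) v n ⟩
    𝟏 n + (((𝟏 ⊕ v) ⋆ v) n + ((𝟏 ⊕ v) ⋆ v) n)
      ≡⟨ cong (𝟏 n +_) (cong₂ _+_ g⋆v g⋆v) ⟩
    (𝟏 ⊕ (g ⋆ v ⊕ g ⋆ v)) n
      ≡⟨ cong (𝟏 n +_) (solve 3 (λ g o x → two (g :* two (x :* (o :* g))) := four (x :* (g :* g :* o))) (λ _ → refl) g o X n) ⟩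
    𝟏 n + (((X ⋆ (s ⋆ o)) n + (X ⋆ (s ⋆ o)) n) + ((X ⋆ (s ⋆ o)) n + (X ⋆ (s ⋆ o)) n))
      ≡⟨ cong (λ z → 𝟏 n + (z + z + (z + z))) (⊛-cong {a = X} (λ _ → refl) (λ m → ⊛-cong {a = s} (λ _ → refl) o-rec (suc m)) (suc n)) ⟩
    𝟏 n + ((so n + so n) + (so n + so n))
      ≡⟨ cong (𝟏 n +_) (solve 3 (λ g o x → four (x :* (g :* g :* (g :* g :+ x :* (o :* o)))) :=
           four (x :* (g :* g :* (g :* g))) :+ two (x :* (o :* g)) :* two (x :* (o :* g))) (λ _ → refl) g o X n) ⟩
    𝟏 n + ((((X ⋆ (s ⋆ s)) n + (X ⋆ (s ⋆ s)) n) + ((X ⋆ (s ⋆ s)) n + (X ⋆ (s ⋆ s)) n)) + (v ⋆ v) n)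
      ≡⟨ cong (λ z → 𝟏 n + (z + z + (z + z) + (v ⋆ v) n)) (X⋆⋆ s s n) ⟩
    𝟏 n + ((((s ⊛ s) n + (s ⊛ s) n) + ((s ⊛ s) n + (s ⊛ s) n)) + (v ⋆ v) n)
      ≡⟨ lemma (𝟏 n) ((s ⊛ s) n) ((v ⋆ v) n) ⟩
    𝟏 n + 4 * (s ⊛ s) n + (v ⋆ v) n ∎)
    where
    so : Series
    so = X ⋆ (s ⋆ (s ⊕ X ⋆ (o ⋆ o)))
    g⋆v : ((𝟏 ⊕ v) ⋆ v) n ≡ (g ⋆ v) n
    g⋆v = ⊛-cong {b = v} (λ m → sym (g-rec m)) (λ _ → refl) (suc n)
    lemma : ∀ e z w → e + (z + z + (z + z) + w) ≡ e + 4 * z + w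
    lemma = solve-∀

-- With h = `avoiding`, o = `catOdd` and g = `catEven`: h = o - 2 X o² by `avoiding-rec` and g² = o
-- - X o² by `catOdd-rec`, so h + o = 2 g², which Shapiro's identity evaluates. The term 2 X o² is
-- added to avoid subtraction.
avoiding-explicit : ∀ n → avoiding n + catOdd n ≡ 2 * (4 ^ n * Cat n)
avoiding-explicit n = +-cancelʳ-≡ (2 * (catOdd ⊛ catOdd) n) _ _ (begin
  avoiding n + catOdd n + 2 * (catOdd ⊛ catOdd) n        ≡⟨ lemma₁ (avoiding n) (catOdd n) ((catOdd ⊛ catOdd) n) ⟩
  avoiding n + 2 * (catOdd ⊛ catOdd) n + catOdd n        ≡⟨ cong (_+ catOdd n) (avoiding-rec n) ⟨
  catOdd n + catOdd n                                    ≡⟨ cong (λ z → z + z) (trans (catOdd-rec n) (cong (_+ (catOdd ⊛ catOdd) n) (shapiro n))) ⟩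
  4 ^ n * Cat n + (catOdd ⊛ catOdd) n + (4 ^ n * Cat n + (catOdd ⊛ catOdd) n)
                                                         ≡⟨ lemma₂ (4 ^ n * Cat n) ((catOdd ⊛ catOdd) n) ⟩
  2 * (4 ^ n * Cat n) + 2 * (catOdd ⊛ catOdd) n          ∎)
  where
  open ≡-Reasoning
  lemma₁ : ∀ h o z → h + o + 2 * z ≡ h + 2 * z + o
  lemma₁ = solve-∀
  lemma₂ : ∀ w z → w + z + (w + z) ≡ 2 * w + 2 * z
  lemma₂ = solve-∀

-- Trees as triangulations

edges edgesRoot : ℕ → Tree → List Segment
edges lo leaf       = []
edges lo (node l r) = edgesRoot lo l ++ edgesRoot (lo + suc (size l)) r
edgesRoot lo leaf         = []
edgesRoot lo t@(node _ _) = (lo , lo + suc (size t)) ∷ edges lo t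

end-node : ∀ lo m n → lo + suc m + suc n ≡ lo + suc (suc (m + n))
end-node = solve-∀

∈-edges⁻ : ∀ {lo e} l r → e ∈ edges lo (node l r) → e ∈ edgesRoot lo l ⊎ e ∈ edgesRoot (lo + suc (size l)) r
∈-edges⁻ {lo} l r = ∈-++⁻ (edgesRoot lo l)

∈-edgesˡ : ∀ {lo e} l r → e ∈ edgesRoot lo l → e ∈ edges lo (node l r)
∈-edgesˡ l r = ∈-++⁺ˡ

∈-edgesʳ : ∀ {lo e} l r → e ∈ edgesRoot (lo + suc (size l)) r → e ∈ edges lo (node l r)
∈-edgesʳ {lo} l r = ∈-++⁺ʳ (edgesRoot lo l)

∈-edgesRoot⁻ : ∀ {lo e} t → e ∈ edgesRoot lo t → (e ≡ (lo , lo + suc (size t)) × 0 < size t) ⊎ e ∈ edges lo t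
∈-edgesRoot⁻ (node l r) (here eq)  = inj₁ (eq , z<s)
∈-edgesRoot⁻ (node l r) (there e∈) = inj₂ e∈

edges⊆edgesRoot : ∀ {lo} t → edges lo t ⊆ edgesRoot lo t
edges⊆edgesRoot (node l r) = there

root∈ : ∀ {lo} t {n} → n ≡ lo + suc (size t) → lo + 1 < n → (lo , n) ∈ edgesRoot lo t
root∈ leaf       refl lt = contradiction lt (<-irrefl refl)
root∈ (node l r) refl lt = here refl

-- The last component excludes the root edge, which for the whole polygon is a side.
edges-bounds : ∀ {lo a b} t → (a , b) ∈ edges lo t →
               lo ≤ a × suc a < b × b ≤ lo + suc (size t) × (lo < a ⊎ b < lo + suc (size t))
edgesRoot-bounds : ∀ {lo a b} t → (a , b) ∈ edgesRoot lo t → lo ≤ a × suc a < b × b ≤ lo + suc (size t)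
edges-bounds {lo} {a} {b} (node l r) e∈ with ∈-edges⁻ l r e∈
... | inj₁ e∈l =
  let lo≤a , a<b , b≤p = edgesRoot-bounds l e∈l
      b<hi = <-≤-trans (s≤s b≤p) (subst (suc (lo + suc (size l)) ≤_) (end-node lo (size l) (size r)) (m<m+n _ z<s))
  in lo≤a , a<b , <⇒≤ b<hi , inj₂ b<hi
... | inj₂ e∈r =
  let p≤a , a<b , b≤hi = edgesRoot-bounds r e∈r
      lo<a = <-≤-trans (m<m+n lo z<s) p≤a
  in <⇒≤ lo<a , a<b , subst (b ≤_) (end-node lo (size l) (size r)) b≤hi , inj₁ lo<a
edgesRoot-bounds {lo} t@(node l r) (here refl) =
  ≤-refl , subst (suc (suc lo) ≤_) (lemma lo (size l + size r)) (m≤m+n (suc (suc lo)) (size l + size r)) , ≤-refl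
  where
  lemma : ∀ lo n → 2 + lo + n ≡ lo + suc (suc n)
  lemma = solve-∀
edgesRoot-bounds t@(node _ _) (there e∈) = let p , q , r , _ = edges-bounds t e∈ in p , q , r

separated : ∀ {a b c d} → b ≤ c → ¬ Crossing (a , b) (c , d)
separated b≤c (inj₁ (_ , c<b , _))     = <-irrefl refl (<-≤-trans c<b b≤c)
separated b≤c (inj₂ (c<a , a<d , d<b)) = <-irrefl refl (<-≤-trans (<-trans c<a (<-trans a<d d<b)) b≤c)

nested : ∀ {a b c d} → a ≤ c → d ≤ b → ¬ Crossing (a , b) (c , d)
nested a≤c d≤b (inj₁ (_ , _ , b<d)) = <-irrefl refl (<-≤-trans b<d d≤b)
nested a≤c d≤b (inj₂ (c<a , _ , _)) = <-irrefl refl (<-≤-trans c<a a≤c)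

irreflexive : ∀ d → ¬ Crossing d d
irreflexive _ = nested ≤-refl ≤-refl

edges-nonCrossing     : ∀ lo t → NonCrossing (edges lo t)
edgesRoot-nonCrossing : ∀ lo t → NonCrossing (edgesRoot lo t)
edges-nonCrossing lo (node l r) {d} {e} d∈ e∈ with ∈-edges⁻ l r d∈ | ∈-edges⁻ l r e∈
... | inj₁ d∈l | inj₁ e∈l = edgesRoot-nonCrossing lo l d∈l e∈l
... | inj₂ d∈r | inj₂ e∈r = edgesRoot-nonCrossing (lo + suc (size l)) r d∈r e∈r
... | inj₁ d∈l | inj₂ e∈r =
  separated (≤-trans (proj₂ (proj₂ (edgesRoot-bounds l d∈l))) (proj₁ (edgesRoot-bounds r e∈r)))
... | inj₂ d∈r | inj₁ e∈l =
  separated (≤-trans (proj₂ (proj₂ (edgesRoot-bounds l e∈l))) (proj₁ (edgesRoot-bounds r d∈r))) ∘ Sum.swap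
edgesRoot-nonCrossing lo t@(node _ _) (here refl) (here refl) = irreflexive _
edgesRoot-nonCrossing lo t@(node _ _) (here refl) (there e∈)  =
  let lo≤a , _ , b≤hi , _ = edges-bounds t e∈ in nested lo≤a b≤hi
edgesRoot-nonCrossing lo t@(node _ _) (there d∈)  (here refl) =
  let lo≤a , _ , b≤hi , _ = edges-bounds t d∈ in nested lo≤a b≤hi ∘ Sum.swap
edgesRoot-nonCrossing lo t@(node _ _) (there d∈)  (there e∈)  = edges-nonCrossing lo t d∈ e∈

-- As long as the segment stays on one side of the apex p, the claim passes to that part. If a < p <
-- b, the segment crosses (lo, p) when lo < a, and (p, hi) when a = lo and b < hi; only the root
-- edge is left.
edges-complete : ∀ {lo a b} t → lo ≤ a → suc a < b → b ≤ lo + suc (size t) →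
                 (∀ {e} → e ∈ edges lo t → ¬ Crossing (a , b) e) → (a , b) ∈ edgesRoot lo t
edges-complete {lo} {a} {b} leaf lo≤a a<b b≤hi nc =
  contradiction (<-≤-trans a<b (≤-trans b≤hi (subst (_≤ suc a) (sym (trans (+-suc lo 0) (cong suc (+-identityʳ lo)))) (s≤s lo≤a)))) (<-irrefl refl)
edges-complete {lo} {a} {b} t@(node l r) lo≤a a<b b≤hi nc with b ≤? lo + suc (size l) | lo + suc (size l) ≤? a
... | yes b≤p | _ = there (∈-edgesˡ l r (edges-complete l lo≤a a<b b≤p (nc ∘ ∈-edgesˡ l r ∘ edges⊆edgesRoot l)))
... | no  _   | yes p≤a = there (∈-edgesʳ l r
  (edges-complete r p≤a a<b (subst (b ≤_) (sym (end-node lo (size l) (size r))) b≤hi) (nc ∘ ∈-edgesʳ l r ∘ edges⊆edgesRoot r)))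
... | no  b≰p | no  p≰a with m≤n⇒m<n∨m≡n lo≤a | m≤n⇒m<n∨m≡n b≤hi
...   | inj₁ lo<a | _ = contradiction
  (inj₂ (lo<a , ≰⇒> p≰a , ≰⇒> b≰p))
  (nc (∈-edgesˡ l r (root∈ l refl (≤-<-trans (subst (_≤ a) (sym (+-comm lo 1)) lo<a) (≰⇒> p≰a)))))
...   | inj₂ refl | inj₁ b<hi = contradiction
  (inj₁ (≰⇒> p≰a , ≰⇒> b≰p , b<hi))
  (nc (∈-edgesʳ l r (root∈ r (sym (end-node lo (size l) (size r)))
    (≤-<-trans (subst (_≤ b) (sym (+-comm (lo + suc (size l)) 1)) (≰⇒> b≰p)) b<hi))))
...   | inj₂ refl | inj₂ refl = here refl

edges-unique     : ∀ lo t → Unique (edges lo t)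
edgesRoot-unique : ∀ lo t → Unique (edgesRoot lo t)
edges-unique lo leaf       = []
edges-unique lo (node l r) = Unique.++⁺ (edgesRoot-unique lo l) (edgesRoot-unique (lo + suc (size l)) r)
  λ (∈l , ∈r) → let _ , a<b , b≤p = edgesRoot-bounds l ∈l
                    p≤a , _ , _   = edgesRoot-bounds r ∈r
                in <-irrefl refl (<-≤-trans (<-trans (n<1+n _) a<b) (≤-trans b≤p p≤a))
edgesRoot-unique lo leaf         = []
edgesRoot-unique lo t@(node _ _) = All.tabulate distinct ∷ edges-unique lo t
  where
  distinct : ∀ {e} → e ∈ edges lo t → (lo , lo + suc (size t)) ≢ e
  distinct e∈ refl with edges-bounds t e∈
  ... | _ , _ , _ , inj₁ lo<lo = <-irrefl refl lo<lo
  ... | _ , _ , _ , inj₂ hi<hi = <-irrefl refl hi<hi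

-- If the apices differ, say p < p′, then (p, hi) from one tree crosses (lo, p′) from the other, yet
-- the inclusion puts both among the edges of `t′`. With equal apices the inclusion splits, since no
-- edge fits into both parts and bounds exclude the root edges.
edges-injective : ∀ {lo} t t′ → size t ≡ size t′ → edges lo t ⊆ edges lo t′ → t ≡ t′
edges-injective leaf leaf _ _ = refl
edges-injective {lo} (node l r) (node l′ r′) eq sub with <-cmp (size l) (size l′)
... | tri< l<l′ _ _ = contradiction
  (inj₁ (m<m+n lo z<s , +-monoʳ-< lo (s≤s l<l′) , p′<hi))
  (edges-nonCrossing lo (node l′ r′)
    (∈-edgesˡ l′ r′ (root∈ l′ refl (+-monoʳ-< lo (s≤s (≤-<-trans z≤n l<l′)))))
    (sub (∈-edgesʳ l r (root∈ r (trans (cong (λ n → lo + suc n) (sym eq)) (sym (end-node lo (size l) (size r))))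
      (≤-<-trans (subst (_≤ lo + suc (size l′)) (lemma lo (size l)) (+-monoʳ-≤ lo (s≤s l<l′))) p′<hi)))))
  where
  lemma : ∀ lo n → lo + suc (suc n) ≡ lo + suc n + 1
  lemma = solve-∀
  p′<hi : lo + suc (size l′) < lo + suc (suc (size l′ + size r′))
  p′<hi = +-monoʳ-< lo (s≤s (s≤s (m≤m+n (size l′) (size r′))))
... | tri> _ _ l′<l = contradiction
  (inj₁ (m<m+n lo z<s , +-monoʳ-< lo (s≤s l′<l) , p<hi))
  (edges-nonCrossing lo (node l′ r′)
    (sub (∈-edgesˡ l r (root∈ l refl (+-monoʳ-< lo (s≤s (≤-<-trans z≤n l′<l))))))
    (∈-edgesʳ l′ r′ (root∈ r′ (trans (cong (λ n → lo + suc n) eq) (sym (end-node lo (size l′) (size r′))))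
      (≤-<-trans (subst (_≤ lo + suc (size l)) (lemma lo (size l′)) (+-monoʳ-≤ lo (s≤s l′<l))) p<hi))))
  where
  lemma : ∀ lo n → lo + suc (suc n) ≡ lo + suc n + 1
  lemma = solve-∀
  p<hi : lo + suc (size l) < lo + suc (suc (size l + size r))
  p<hi = +-monoʳ-< lo (s≤s (s≤s (m≤m+n (size l) (size r))))
... | tri≈ _ l≡l′ _ = cong₂ node
  (edges-injective l l′ l≡l′ subˡ)
  (edges-injective r r′ (+-cancelˡ-≡ (size l) _ _ (trans (suc-injective eq) (cong (_+ size r′) (sym l≡l′)))) subʳ)
  where
  subˡ : edges lo l ⊆ edges lo l′
  subˡ {a , b} e∈ with edges-bounds l e∈ | ∈-edges⁻ l′ r′ (sub (∈-edgesˡ l r (edges⊆edgesRoot l e∈)))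
  ... | _ , a<b , b≤p , strict | inj₂ e∈r′ = contradiction
    (<-≤-trans (<-trans (n<1+n a) a<b) (≤-trans b≤p (subst (λ n → lo + suc n ≤ a) (sym l≡l′) (proj₁ (edgesRoot-bounds r′ e∈r′)))))
    (<-irrefl refl)
  ... | _ , _ , _ , strict | inj₁ e∈l′ with ∈-edgesRoot⁻ l′ e∈l′ | strict
  ...   | inj₂ e∈l″        | _          = e∈l″
  ...   | inj₁ (refl , _)  | inj₁ lo<lo = contradiction lo<lo (<-irrefl refl)
  ...   | inj₁ (refl , _)  | inj₂ p′<p  = contradiction p′<p (<-irrefl (cong (λ n → lo + suc n) (sym l≡l′)))
  subʳ : edges (lo + suc (size l)) r ⊆ edges (lo + suc (size l)) r′
  subʳ {a , b} e∈ with edges-bounds r e∈ | ∈-edges⁻ l′ r′ (sub (∈-edgesʳ l r (edges⊆edgesRoot r e∈)))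
  ... | p≤a , a<b , _ , strict | inj₁ e∈l′ = contradiction
    (<-≤-trans (<-trans (n<1+n a) a<b) (≤-trans (proj₂ (proj₂ (edgesRoot-bounds l′ e∈l′))) (subst (λ n → lo + suc n ≤ a) l≡l′ p≤a)))
    (<-irrefl refl)
  ... | _ , _ , _ , strict | inj₂ e∈r′ with ∈-edgesRoot⁻ r′ e∈r′ | strict
  ...   | inj₂ e∈r″        | _          = subst (λ n → (a , b) ∈ edges (lo + suc n) r′) (sym l≡l′) e∈r″
  ...   | inj₁ (refl , _)  | inj₁ p<p′  = contradiction p<p′ (<-irrefl (cong (λ n → lo + suc n) l≡l′))
  ...   | inj₁ (refl , _)  | inj₂ hi<hi = contradiction hi<hi
    (<-irrefl (trans (end-node lo (size l′) (size r′)) (trans (cong (λ n → lo + suc n) (sym eq)) (sym (end-node lo (size l) (size r))))))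

edges-central     : ∀ s lo t → count (λ (a , b) → a + b) s (edges lo t) ≡ central (s ∸ double lo) t
edgesRoot-central : ∀ s lo t → count (λ (a , b) → a + b) s (edgesRoot lo t) ≡ centralEdge (s ∸ double lo) t
edges-central s lo leaf       = refl
edges-central s lo (node l r) = trans
  (count-++ (λ (a , b) → a + b) s (edgesRoot lo l) _)
  (cong₂ _+_ (edgesRoot-central s lo l)
    (trans (edgesRoot-central s (lo + suc (size l)) r) (cong (λ d → centralEdge d r)
      (trans (cong (s ∸_) (double-+ lo (suc (size l)))) (sym (∸-+-assoc s (double lo) (double (suc (size l)))))))))
edgesRoot-central s lo leaf         = refl
edgesRoot-central s lo t@(node _ _) = trans
  (count-∷ (λ (a , b) → a + b) s (lo , lo + suc (size t)) (edges lo t))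
  (cong₂ _+_ (trans (count-[] (λ (a , b) → a + b) s (lo , lo + suc (size t))) root) (edges-central s lo t))
  where
  root : count (λ n → n) s [ lo + (lo + suc (size t)) ] ≡ count (λ n → n) (s ∸ double lo) [ suc (size t) ]
  root with lo + (lo + suc (size t)) ≟ s
  ... | yes refl = trans (count-[]-≡ {lo + (lo + suc (size t))} refl) (sym (count-[]-≡ (sym (trans
    (cong₂ _∸_ (sym (+-assoc lo lo (suc (size t)))) (double≡+ lo)) (m+n∸m≡n (lo + lo) (suc (size t)))))))
  -- A truncated difference equal to the positive number `suc (size t)` was not truncated.
  ... | no  ≢s   = trans (count-[]-≢ ≢s) (sym (count-[]-≢ λ eq → ≢s (begin
    lo + (lo + suc (size t))      ≡⟨ +-assoc lo lo (suc (size t)) ⟨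
    lo + lo + suc (size t)        ≡⟨ cong₂ _+_ (sym (double≡+ lo)) eq ⟩
    double lo + (s ∸ double lo)   ≡⟨ m+[n∸m]≡n (<⇒≤ (lo+lo<s eq)) ⟩
    s                             ∎)))
    where
    open ≡-Reasoning
    lo+lo<s : suc (size t) ≡ s ∸ double lo → double lo < s
    lo+lo<s eq = m∸n≢0⇒n<m λ eq₀ → contradiction (trans eq eq₀) λ ()

greatest : ∀ {P : ℕ → Set} → Decidable P → P 0 → ∀ m →
           ∃ λ j → j ≤ m × P j × (∀ i → j < i → i ≤ m → ¬ P i)
greatest P? p zero = 0 , z≤n , p , λ i 0<i i≤0 _ → contradiction (<-≤-trans 0<i i≤0) (<-irrefl refl)
greatest {P} P? p (suc m) with P? (suc m) | greatest P? p m
... | yes pm | _ = suc m , ≤-refl , pm , λ i m<i i≤m _ → contradiction (<-≤-trans m<i i≤m) (<-irrefl refl)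
... | no ¬pm | j , j≤m , pj , last = j , m≤n⇒m≤1+n j≤m , pj , λ i j<i i≤1+m →
  Sum.[ last i j<i ∘ ≤-pred , (λ eq → ¬pm ∘ subst P eq) ]′ (m≤n⇒m<n∨m≡n i≤1+m)

-- The triangle on the root edge (lo , hi) has its apex p at the last neighbour of lo before hi:
-- a segment crossing (p , hi) would cross (lo , hi) or (lo , p), or else start at lo and end after p.
subtriangulation : ∀ {N T} → NonCrossing T →
  (∀ d → IsDiagonal N d → (∀ {e} → e ∈ T → ¬ Crossing d e) → d ∈ T) →
  ∀ m lo → lo + suc m < N → (∀ {e} → e ∈ T → ¬ Crossing (lo , lo + suc m) e) →
  ∃ λ t → size t ≡ m × edges lo t ⊆ T
subtriangulation {N} {T} nc max = <-rec _ go
  where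
  go : ∀ m → (∀ {i} → i < m → ∀ lo → lo + suc i < N → (∀ {e} → e ∈ T → ¬ Crossing (lo , lo + suc i) e) →
               ∃ λ t → size t ≡ i × edges lo t ⊆ T) →
       ∀ lo → lo + suc m < N → (∀ {e} → e ∈ T → ¬ Crossing (lo , lo + suc m) e) →
       ∃ λ t → size t ≡ m × edges lo t ⊆ T
  go zero    rec lo hi<N nc-root = leaf , refl , λ ()
  go (suc m) rec lo hi<N nc-root = combine (greatest near? (inj₁ refl) m)
    where
    Near : ℕ → Set
    Near j = j ≡ 0 ⊎ (lo , lo + suc j) ∈ T
    near? : Decidable Near
    near? j = (j ≟ 0) ⊎-dec ((lo , lo + suc j) ∈? T)

    combine : (∃ λ j → j ≤ m × Near j × (∀ i → j < i → i ≤ m → ¬ Near i)) →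
              ∃ λ t → size t ≡ suc m × edges lo t ⊆ T
    combine (j , j≤m , near , last) = join
      (rec (s≤s j≤m) lo (<-trans p<hi hi<N) nc-left)
      (rec {m ∸ j} (s≤s (m∸n≤m m j)) p (subst (_< N) (sym p+≡hi) hi<N)
        λ {e} e∈ → subst (λ h → ¬ Crossing (p , h) e) (sym p+≡hi) (nc-right e∈))
      where
      p  = lo + suc j
      hi = lo + suc (suc m)
      p<hi : p < hi
      p<hi = +-monoʳ-< lo (s≤s (s≤s j≤m))
      p+≡hi : p + suc (m ∸ j) ≡ hi
      p+≡hi = trans (end-node lo j (m ∸ j)) (cong (λ n → lo + suc (suc n)) (m+[n∸m]≡n j≤m))

      nc-from : Near j → ∀ {e} → e ∈ T → ¬ Crossing (lo , p) e
      nc-from (inj₂ lop∈) e∈ cr = nc lop∈ e∈ cr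
      nc-from (inj₁ refl) {c , d} e∈ (inj₁ (lo<c , c<p , _)) =
        <-irrefl refl (<-≤-trans (s≤s lo<c) (subst (suc c ≤_) (+-comm lo 1) c<p))
      nc-from (inj₁ refl) {c , d} e∈ (inj₂ (_ , lo<d , d<p)) =
        <-irrefl refl (<-≤-trans (s≤s lo<d) (subst (suc d ≤_) (+-comm lo 1) d<p))

      nc-left : ∀ {e} → e ∈ T → ¬ Crossing (lo , p) e
      nc-left = nc-from near

      nc-right : ∀ {e} → e ∈ T → ¬ Crossing (p , hi) e
      nc-right e∈ (inj₁ (p<c , c<hi , hi<d)) = nc-root e∈ (inj₁ (<-trans (m<m+n lo z<s) p<c , c<hi , hi<d))
      nc-right {c , d} e∈ (inj₂ (c<p , p<d , d<hi)) with <-cmp c lo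
      ... | tri< c<lo _ _ = nc-root e∈ (inj₂ (c<lo , <-trans (m<m+n lo z<s) p<d , d<hi))
      ... | tri> _ _ lo<c = nc-left e∈ (inj₁ (lo<c , c<p , p<d))
      ... | tri≈ _ refl _ = last (d ∸ suc lo)
        (+-cancelˡ-< (suc lo) _ _ (subst₂ _<_ (+-suc lo j) (sym d≡) p<d))
        (≤-pred (+-cancelˡ-< (suc lo) _ _ (subst₂ _<_ (sym d≡) (+-suc lo (suc m)) d<hi)))
        (inj₂ (subst (λ n → (lo , n) ∈ T) (trans (sym d≡) (sym (+-suc lo (d ∸ suc lo)))) e∈))
        where
        d≡ : suc lo + (d ∸ suc lo) ≡ d
        d≡ = m+[n∸m]≡n (<-trans (m<m+n lo z<s) p<d)

      join : (∃ λ t → size t ≡ j × edges lo t ⊆ T) → (∃ λ t → size t ≡ m ∸ j × edges p t ⊆ T) →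
             ∃ λ t → size t ≡ suc m × edges lo t ⊆ T
      join (l , refl , l⊆) (r , r≡ , r⊆) = node l r , cong suc (trans (cong (size l +_) r≡) (m+[n∸m]≡n j≤m)) ,
        λ e∈ → Sum.[ inl ∘ ∈-edgesRoot⁻ l , inr ∘ ∈-edgesRoot⁻ r ]′ (∈-edges⁻ l r e∈)
        where
        inl : ∀ {e} → (e ≡ (lo , p) × 0 < size l) ⊎ e ∈ edges lo l → e ∈ T
        inl (inj₂ e∈) = l⊆ e∈
        inl (inj₁ (refl , 0<l)) = Sum.[ (λ l≡0 → contradiction 0<l (<-irrefl (sym l≡0))) , id ]′ near
        inr : ∀ {e} → (e ≡ (p , p + suc (size r)) × 0 < size r) ⊎ e ∈ edges p r → e ∈ T
        inr (inj₂ e∈) = r⊆ e∈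
        inr (inj₁ (refl , 0<r)) rewrite r≡ | p+≡hi = max (p , hi) (p<hi , hi<N , notSide) nc-right
          where
          notSide : ¬ IsSide N (p , hi)
          notSide (inj₂ (p≡0 , _)) = contradiction (trans (sym (+-suc lo j)) p≡0) λ ()
          notSide (inj₁ hi≡) = contradiction 0<r (<-irrefl (sym (suc-injective
            (+-cancelˡ-≡ p _ _ (trans p+≡hi (trans hi≡ (sym (+-comm p 1))))))))

suc<-diagonal : ∀ {N a b} → IsDiagonal N (a , b) → suc a < b
suc<-diagonal (a<b , _ , notSide) = ≤∧≢⇒< a<b λ eq → notSide (inj₁ (sym eq))

maximal-one : ∀ {N T} → IsTriangulation N T →
              ∀ d → IsDiagonal N d → (∀ {e} → e ∈ T → ¬ Crossing d e) → d ∈ T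
maximal-one {N} {T} tri d diag nc-d = maximal (d ∷ T) (diag ∷ areDiagonals) extended there (here refl)
  where
  open IsTriangulation tri
  extended : NonCrossing (d ∷ T)
  extended (here refl) (here refl) = irreflexive d
  extended (here refl) (there e∈)  = nc-d e∈
  extended (there e∈)  (here refl) = nc-d e∈ ∘ Sum.swap
  extended (there d∈)  (there e∈)  = nonCrossing d∈ e∈

edges-diagonals : ∀ {e} t → e ∈ edges 0 t → IsDiagonal (2 + size t) e
edges-diagonals t e∈ with edges-bounds t e∈
... | _ , a<b , b≤hi , strict = <-trans (n<1+n _) a<b , s≤s b≤hi , λ where
  (inj₁ refl)          → <-irrefl refl a<b
  (inj₂ (refl , refl)) → Sum.[ <-irrefl refl , <-irrefl refl ]′ strict

edges-maximal : ∀ {d} t → IsDiagonal (2 + size t) d → (∀ {e} → e ∈ edges 0 t → ¬ Crossing d e) → d ∈ edges 0 t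
edges-maximal t diag@(_ , s≤s b≤hi , notSide) nc
  with ∈-edgesRoot⁻ t (edges-complete t z≤n (suc<-diagonal diag) b≤hi nc)
... | inj₁ (refl , _) = contradiction (inj₂ (refl , refl)) notSide
... | inj₂ e∈         = e∈

edges-isTriangulation : ∀ t → IsTriangulation (2 + size t) (edges 0 t)
edges-isTriangulation t = record
  { areDiagonals = All.tabulate (edges-diagonals t)
  ; nonCrossing  = edges-nonCrossing 0 t
  ; maximal      = λ S dS ncS ⊆S d∈S → edges-maximal t (All.lookup dS d∈S) (ncS d∈S ∘ ⊆S)
  }

-- Only `edges 0 t ⊆ T` has to be constructed. Since `edges 0 t` is itself maximal, the diagonals of
-- `T`, which do not cross it, all belong to it.
triangulation⇒edges : ∀ m {T} → IsTriangulation (2 + m) T → ∃ λ t → size t ≡ m × edges 0 t ⊆ T × T ⊆ edges 0 t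
triangulation⇒edges m {T} tri
  with subtriangulation nonCrossing (maximal-one tri) m 0 ≤-refl nc-root
  where
  open IsTriangulation tri
  nc-root : ∀ {e} → e ∈ T → ¬ Crossing (0 , suc m) e
  nc-root e∈ with All.lookup areDiagonals e∈
  ... | _ , s≤s b≤ , _ = nested z≤n b≤
... | t , refl , ⊆T = t , refl , ⊆T ,
  λ d∈ → edges-maximal t (All.lookup areDiagonals d∈) (nonCrossing d∈ ∘ ⊆T)
  where open IsTriangulation tri

-- Rotation and the enumeration of triangulations

↭-set : ∀ {A : Set} {xs ys : List A} → Unique xs → Unique ys → xs ⊆ ys → ys ⊆ xs → xs ↭ ys
↭-set uxs uys xs⊆ys ys⊆xs = ∼bag⇒↭ (unique∧set⇒bag uxs uys (mk⇔ xs⊆ys ys⊆xs))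

filter-cong-local : ∀ {A : Set} {P Q : A → Set} (P? : Decidable P) (Q? : Decidable Q) xs →
                    (∀ {x} → x ∈ xs → P x → Q x) → (∀ {x} → x ∈ xs → Q x → P x) →
                    filter P? xs ≡ filter Q? xs
filter-cong-local P? Q? []       to from = refl
filter-cong-local P? Q? (x ∷ xs) to from with P? x | Q? x
... | yes _ | yes _ = cong (x ∷_) (filter-cong-local P? Q? xs (to ∘ there) (from ∘ there))
... | no  _ | no  _ = filter-cong-local P? Q? xs (to ∘ there) (from ∘ there)
... | yes p | no ¬q = contradiction (to (here refl) p) ¬q
... | no ¬p | yes q = contradiction (from (here refl) q) ¬p

length-filter-map : ∀ {A B : Set} {P : B → Set} (P? : Decidable P) (φ : A → B) xs →
                    length (filter P? (map φ xs)) ≡ length (filter (P? ∘ φ) xs)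
length-filter-map P? φ []       = refl
length-filter-map P? φ (x ∷ xs) with does (P? (φ x))
... | true  = cong suc (length-filter-map P? φ xs)
... | false = length-filter-map P? φ xs

map-unique : ∀ {A B : Set} (φ : A → B) {xs} → (∀ {x y} → x ∈ xs → y ∈ xs → φ x ≡ φ y → x ≡ y) →
             Unique xs → Unique (map φ xs)
map-unique φ inj []         = []
map-unique φ inj (x∉ ∷ uxs) =
  All.map⁺ (All.tabulate λ y∈ eq → All.lookup x∉ y∈ (inj (here refl) (there y∈) eq))
  ∷ map-unique φ (λ x∈ y∈ → inj (there x∈) (there y∈)) uxs

filter∈subsets : ∀ {A : Set} {P : A → Set} (P? : Decidable P) xs → filter P? xs ∈ subsets xs
filter∈subsets P? []       = here refl
filter∈subsets P? (x ∷ xs) with does (P? x)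
... | true  = ∈-++⁺ˡ (∈-map⁺ (x ∷_) (filter∈subsets P? xs))
... | false = ∈-++⁺ʳ (map (x ∷_) (subsets xs)) (filter∈subsets P? xs)

∈-subsets⁻ : ∀ {A : Set} (xs : List A) {s} → s ∈ subsets xs → s ⊆ xs
∈-subsets⁻ []       (here refl) ()
∈-subsets⁻ (x ∷ xs) s∈ y∈ with ∈-++⁻ (map (x ∷_) (subsets xs)) s∈
... | inj₂ s∈′ = there (∈-subsets⁻ xs s∈′ y∈)
... | inj₁ s∈′ with ∈-map⁻ (x ∷_) s∈′
...   | s′ , s′∈ , refl with y∈
...     | here refl = here refl
...     | there y∈′ = there (∈-subsets⁻ xs s′∈ y∈′)

subsets-unique : ∀ {A : Set} {xs : List A} → Unique xs → Unique (subsets xs)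
subsets-unique []                      = [] ∷ []
subsets-unique {xs = x ∷ xs} (x∉ ∷ uxs) = Unique.++⁺
  (Unique.map⁺ ∷-injectiveʳ (subsets-unique uxs)) (subsets-unique uxs) disjoint
  where
  disjoint : ∀ {s} → ¬ (s ∈ map (x ∷_) (subsets xs) × s ∈ subsets xs)
  disjoint (s∈₁ , s∈₂) with ∈-map⁻ (x ∷_) s∈₁
  ... | _ , _ , refl = All.lookup x∉ (∈-subsets⁻ xs s∈₂ (here refl)) refl

-- An entry of `subsets xs` is determined by its set of elements, so that triangulations can be
-- compared as sets.
subsets-filter : ∀ xs {s} → Unique xs → s ∈ subsets xs → filter (_∈? s) xs ≡ s
subsets-filter []       _          (here refl) = refl
subsets-filter (x ∷ xs) {s} (x∉ ∷ uxs) s∈ with ∈-++⁻ (map (x ∷_) (subsets xs)) s∈ | x ∈? s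
... | inj₂ s∈′ | yes x∈s = contradiction refl (All.lookup x∉ (∈-subsets⁻ xs s∈′ x∈s))
... | inj₂ s∈′ | no  _   = subsets-filter xs uxs s∈′
... | inj₁ s∈′ | x∈?s with ∈-map⁻ (x ∷_) s∈′
...   | s′ , s′∈ , refl with x∈?s
...     | no  x∉s = contradiction (here refl) x∉s
...     | yes _   = cong (x ∷_) (trans
  (filter-cong-local (_∈? (x ∷ s′)) (_∈? s′) xs
    (λ { y∈ (here refl) → contradiction refl (All.lookup x∉ y∈) ; _ (there y∈) → y∈ }) (λ _ → there))
  (subsets-filter xs uxs s′∈))

diagonals-unique : ∀ N → Unique (diagonals N)
diagonals-unique N = Unique.filter⁺ (isDiagonal? N) (Unique.cartesianProduct⁺ (Unique.upTo⁺ N) (Unique.upTo⁺ N))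

-- `triangulations` lists each set once, in the order of `diagonals N`; this puts an arbitrary list
-- of diagonals into that order.
canonical : ℕ → List Segment → List Segment
canonical N T = filter (_∈? T) (diagonals N)

canonical⊆ : ∀ N T → canonical N T ⊆ T
canonical⊆ N T d∈ = proj₂ (∈-filter⁻ (_∈? T) {xs = diagonals N} d∈)

⊆canonical : ∀ {N T} → All (IsDiagonal N) T → T ⊆ canonical N T
⊆canonical {N} {T} diag d∈ = ∈-filter⁺ (_∈? T) (∈-diagonals⁺ (All.lookup diag d∈)) d∈

canonical-cong : ∀ N {S T} → S ⊆ T → T ⊆ S → canonical N S ≡ canonical N T
canonical-cong N {S} {T} S⊆T T⊆S = filter-cong-local (_∈? S) (_∈? T) (diagonals N) (λ _ → S⊆T) (λ _ → T⊆S)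

isTriangulation-resp : ∀ {N S T} → S ⊆ T → T ⊆ S → IsTriangulation N S → IsTriangulation N T
isTriangulation-resp S⊆T T⊆S tri = record
  { areDiagonals = All.tabulate λ d∈ → All.lookup areDiagonals (T⊆S d∈)
  ; nonCrossing  = λ d∈ e∈ → nonCrossing (T⊆S d∈) (T⊆S e∈)
  ; maximal      = λ U dU ncU T⊆U → S⊆T ∘ maximal U dU ncU (T⊆U ∘ S⊆T)
  }
  where open IsTriangulation tri

canonical∈triangulations : ∀ {N T} → IsTriangulation N T → canonical N T ∈ triangulations N
canonical∈triangulations {N} {T} tri = ∈-filter⁺ (isTriangulation? N) (filter∈subsets (_∈? T) (diagonals N))
  (isTriangulation-resp (⊆canonical (IsTriangulation.areDiagonals tri)) (canonical⊆ N T) tri)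

triangulations-canonical : ∀ {N T} → T ∈ triangulations N → IsTriangulation N T × canonical N T ≡ T
triangulations-canonical {N} T∈ =
  let T∈subsets , tri = ∈-filter⁻ (isTriangulation? N) {xs = subsets (diagonals N)} T∈
  in tri , subsets-filter (diagonals N) (diagonals-unique N) T∈subsets

-- The rotation v ↦ v + 1 of the N-gon and its inverse, on segments with the smaller end first.
rotate rotate⁻¹ : ℕ → Segment → Segment
rotate N (a , b) with suc b ≟ N
... | yes _ = 0 , suc a
... | no  _ = suc a , suc b
rotate⁻¹ N (zero  , b) = pred b , pred N
rotate⁻¹ N (suc a , b) = a , pred b

rotate-diagonal : ∀ {N} d → IsDiagonal N d → IsDiagonal N (rotate N d)
rotate-diagonal {N} (a , b) (a<b , b<N , notSide) with suc b ≟ N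
... | yes eq = z<s , ≤-<-trans a<b b<N , λ where
  (inj₁ refl)      → notSide (inj₂ (refl , eq))
  (inj₂ (_ , eq′)) → notSide (inj₁ (suc-injective (trans eq (sym eq′))))
... | no ≢N  = s<s a<b , ≤∧≢⇒< b<N ≢N , λ where
  (inj₁ eq) → notSide (inj₁ (suc-injective eq))

rotate⁻¹-diagonal : ∀ {N} d → IsDiagonal N d → IsDiagonal N (rotate⁻¹ N d)
rotate⁻¹-diagonal {suc N} (zero , suc b) (_ , s≤s b<N , notSide) = b<N , ≤-refl , λ where
  (inj₁ N≡)       → notSide (inj₂ (refl , cong suc (sym N≡)))
  (inj₂ (b≡0 , _)) → notSide (inj₁ (cong suc b≡0))
rotate⁻¹-diagonal {suc N} (suc a , suc b) (s≤s a<b , s≤s b<N , notSide) = a<b , m≤n⇒m≤1+n b<N , λ where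
  (inj₁ b≡)       → notSide (inj₁ (cong suc b≡))
  (inj₂ (_ , b≡N)) → <-irrefl (suc-injective b≡N) b<N

rotate-rotate⁻¹ : ∀ {N} d → IsDiagonal N d → rotate N (rotate⁻¹ N d) ≡ d
rotate-rotate⁻¹ {suc N} (zero , suc b) (_ , s≤s b<N , notSide) with suc N ≟ suc N
... | yes _ = refl
... | no ≢N = contradiction refl ≢N
rotate-rotate⁻¹ {suc N} (suc a , suc b) (s≤s a<b , s≤s b<N , notSide) with suc b ≟ suc N
... | yes eq = contradiction b<N (<-irrefl (suc-injective eq))
... | no  _  = refl

rotate⁻¹-rotate : ∀ {N} d → IsDiagonal N d → rotate⁻¹ N (rotate N d) ≡ d
rotate⁻¹-rotate {N} (a , b) (a<b , b<N , notSide) with suc b ≟ N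
... | yes refl = refl
... | no  _    = refl

-- A segment ending at N - 1 wraps round to start at 0, which exchanges the two alternatives of
-- `Crossing`. Two such segments share an endpoint and do not cross.
rotate-crossing⁻ : ∀ {N} d e → IsDiagonal N d → IsDiagonal N e → Crossing (rotate N d) (rotate N e) → Crossing d e
rotate-crossing⁻ {N} (a , b) (c , d) (a<b , b<N , _) (c<d , d<N , _) cr with suc b ≟ N | suc d ≟ N
rotate-crossing⁻ _ _ _ _ (inj₁ (() , _)) | yes _ | yes _
rotate-crossing⁻ _ _ _ _ (inj₂ (() , _)) | yes _ | yes _
rotate-crossing⁻ _ _ _ (_ , d<N , _) (inj₁ (_ , s≤s c<a , s≤s a<d)) | yes refl | no ≢N =
  inj₂ (c<a , a<d , ≤-pred (≤∧≢⇒< d<N ≢N))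
rotate-crossing⁻ _ _ (_ , b<N , _) _ (inj₂ (_ , s≤s a<c , s≤s c<b)) | no ≢N | yes refl =
  inj₁ (a<c , c<b , ≤-pred (≤∧≢⇒< b<N ≢N))
rotate-crossing⁻ _ _ _ _ (inj₁ (s≤s p , s≤s q , s≤s r)) | no _ | no _ = inj₁ (p , q , r)
rotate-crossing⁻ _ _ _ _ (inj₂ (s≤s p , s≤s q , s≤s r)) | no _ | no _ = inj₂ (p , q , r)

rotate-crossing⁺ : ∀ {N} d e → IsDiagonal N d → IsDiagonal N e → Crossing d e → Crossing (rotate N d) (rotate N e)
rotate-crossing⁺ {N} (a , b) (c , d) (a<b , b<N , _) (c<d , d<N , _) cr with suc b ≟ N | suc d ≟ N
rotate-crossing⁺ _ _ _ _ (inj₁ (_ , _ , b<d)) | yes refl | yes refl = contradiction b<d (<-irrefl refl)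
rotate-crossing⁺ _ _ _ _ (inj₂ (_ , _ , d<b)) | yes refl | yes refl = contradiction d<b (<-irrefl refl)
rotate-crossing⁺ _ _ _ (_ , d<N , _) (inj₁ (_ , _ , b<d)) | yes refl | no ≢N =
  contradiction (<-≤-trans b<d (≤-pred d<N)) (<-irrefl refl)
rotate-crossing⁺ _ _ _ _ (inj₂ (c<a , a<d , _)) | yes refl | no ≢N = inj₁ (z<s , s<s c<a , s<s a<d)
rotate-crossing⁺ _ _ _ _ (inj₁ (a<c , c<b , _)) | no ≢N | yes refl = inj₂ (z<s , s<s a<c , s<s c<b)
rotate-crossing⁺ _ _ (_ , b<N , _) _ (inj₂ (_ , _ , d<b)) | no ≢N | yes refl =
  contradiction (<-≤-trans d<b (≤-pred b<N)) (<-irrefl refl)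
rotate-crossing⁺ _ _ _ _ (inj₁ (p , q , r)) | no _ | no _ = inj₁ (s<s p , s<s q , s<s r)
rotate-crossing⁺ _ _ _ _ (inj₂ (p , q , r)) | no _ | no _ = inj₂ (s<s p , s<s q , s<s r)

rotate⁻¹-crossing⁻ : ∀ {N} d e → IsDiagonal N d → IsDiagonal N e → Crossing (rotate⁻¹ N d) (rotate⁻¹ N e) → Crossing d e
rotate⁻¹-crossing⁻ {N} d e dd de cr = subst₂ Crossing (rotate-rotate⁻¹ d dd) (rotate-rotate⁻¹ e de)
  (rotate-crossing⁺ (rotate⁻¹ N d) (rotate⁻¹ N e) (rotate⁻¹-diagonal d dd) (rotate⁻¹-diagonal e de) cr)

module _ {N : ℕ} (φ ψ : Segment → Segment)
  (φ-diagonal : ∀ d → IsDiagonal N d → IsDiagonal N (φ d))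
  (ψ-diagonal : ∀ d → IsDiagonal N d → IsDiagonal N (ψ d))
  (φψ : ∀ d → IsDiagonal N d → φ (ψ d) ≡ d)
  (ψφ : ∀ d → IsDiagonal N d → ψ (φ d) ≡ d)
  (φ-crossing : ∀ d e → IsDiagonal N d → IsDiagonal N e → Crossing (φ d) (φ e) → Crossing d e)
  (ψ-crossing : ∀ d e → IsDiagonal N d → IsDiagonal N e → Crossing (ψ d) (ψ e) → Crossing d e)
  where

  map-diagonal : ∀ (χ : Segment → Segment) → (∀ d → IsDiagonal N d → IsDiagonal N (χ d)) →
                 ∀ {T} → All (IsDiagonal N) T → All (IsDiagonal N) (map χ T)
  map-diagonal χ χ-diagonal dT = All.map⁺ (All.map (λ {d} → χ-diagonal d) dT)

  map-nonCrossing : ∀ (χ : Segment → Segment) →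
    (∀ d e → IsDiagonal N d → IsDiagonal N e → Crossing (χ d) (χ e) → Crossing d e) →
    ∀ {T} → All (IsDiagonal N) T → NonCrossing T → NonCrossing (map χ T)
  map-nonCrossing χ χ-crossing dT ncT d∈ e∈ with ∈-map⁻ χ d∈ | ∈-map⁻ χ e∈
  ... | d , d∈T , refl | e , e∈T , refl =
    ncT d∈T e∈T ∘ χ-crossing d e (All.lookup dT d∈T) (All.lookup dT e∈T)

  -- For maximality, the larger set is pulled back along `ψ` and compared with `T` there.
  map-isTriangulation : ∀ {T} → IsTriangulation N T → IsTriangulation N (map φ T)
  map-isTriangulation {T} tri = record
    { areDiagonals = map-diagonal φ φ-diagonal areDiagonals
    ; nonCrossing  = map-nonCrossing φ φ-crossing areDiagonals nonCrossing
    ; maximal      = λ S dS ncS φT⊆S {d} d∈S → subst (_∈ map φ T) (φψ d (All.lookup dS d∈S))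
        (∈-map⁺ φ (maximal (map ψ S) (map-diagonal ψ ψ-diagonal dS) (map-nonCrossing ψ ψ-crossing dS ncS)
          (λ {e} e∈T → subst (_∈ map ψ S) (ψφ e (All.lookup areDiagonals e∈T)) (∈-map⁺ ψ (φT⊆S (∈-map⁺ φ e∈T))))
          (∈-map⁺ ψ d∈S)))
    }
    where open IsTriangulation tri

rotate-isTriangulation : ∀ {N T} → IsTriangulation N T → IsTriangulation N (map (rotate N) T)
rotate-isTriangulation {N} = map-isTriangulation (rotate N) (rotate⁻¹ N)
  rotate-diagonal rotate⁻¹-diagonal rotate-rotate⁻¹ rotate⁻¹-rotate rotate-crossing⁻ rotate⁻¹-crossing⁻

rotate⁻¹-isTriangulation : ∀ {N T} → IsTriangulation N T → IsTriangulation N (map (rotate⁻¹ N) T)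
rotate⁻¹-isTriangulation {N} = map-isTriangulation (rotate⁻¹ N) (rotate N)
  rotate⁻¹-diagonal rotate-diagonal rotate⁻¹-rotate rotate-rotate⁻¹ rotate⁻¹-crossing⁻ rotate-crossing⁻

rotatedEdges : ℕ → Tree → List Segment
rotatedEdges m t = map (rotate (2 + m)) (edges 0 t)

triangulationOf : ℕ → Tree → List Segment
triangulationOf m t = canonical (2 + m) (rotatedEdges m t)

module _ {m t} (t∈ : t ∈ trees m) where

  rotatedEdges-diagonals : ∀ {d} → d ∈ edges 0 t → IsDiagonal (2 + m) d
  rotatedEdges-diagonals d∈ = subst (λ m → IsDiagonal (2 + m) _) (∈-trees⁻ m t∈) (edges-diagonals t d∈)

  rotatedEdges-isTriangulation : IsTriangulation (2 + m) (rotatedEdges m t)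
  rotatedEdges-isTriangulation =
    rotate-isTriangulation (subst (λ m → IsTriangulation (2 + m) _) (∈-trees⁻ m t∈) (edges-isTriangulation t))

  rotatedEdges-unique : Unique (rotatedEdges m t)
  rotatedEdges-unique = map-unique (rotate (2 + m))
    (λ {d} {e} d∈ e∈ eq → trans (sym (rotate⁻¹-rotate d (rotatedEdges-diagonals d∈)))
      (trans (cong (rotate⁻¹ (2 + m)) eq) (rotate⁻¹-rotate e (rotatedEdges-diagonals e∈))))
    (edges-unique 0 t)

triangulationOf-injective : ∀ m {t t′} → t ∈ trees m → t′ ∈ trees m →
  triangulationOf m t ≡ triangulationOf m t′ → t ≡ t′
triangulationOf-injective m {t} {t′} t∈ t′∈ eq =
  edges-injective t t′ (trans (∈-trees⁻ m t∈) (sym (∈-trees⁻ m t′∈))) sub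
  where
  sub : edges 0 t ⊆ edges 0 t′
  sub {d} d∈ with ∈-map⁻ (rotate (2 + m)) (canonical⊆ (2 + m) (rotatedEdges m t′)
    (subst (rotate (2 + m) d ∈_) eq (⊆canonical (IsTriangulation.areDiagonals (rotatedEdges-isTriangulation t∈)) (∈-map⁺ (rotate (2 + m)) d∈))))
  ... | e , e∈ , eq′ = subst (_∈ edges 0 t′)
    (trans (sym (rotate⁻¹-rotate e (rotatedEdges-diagonals t′∈ e∈)))
      (trans (cong (rotate⁻¹ (2 + m)) (sym eq′)) (rotate⁻¹-rotate d (rotatedEdges-diagonals t∈ d∈)))) e∈

triangulationOf-surjective : ∀ m {T} → T ∈ triangulations (2 + m) →
  ∃ λ t → t ∈ trees m × triangulationOf m t ≡ T
triangulationOf-surjective m {T} T∈ with triangulations-canonical T∈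
... | tri , canon with triangulation⇒edges m (rotate⁻¹-isTriangulation tri)
...   | t , refl , ⊆T , T⊆ = t , ∈-trees⁺ t , trans (canonical-cong (2 + m) to from) canon
  where
  open IsTriangulation tri
  to : rotatedEdges m t ⊆ T
  to d∈ with ∈-map⁻ (rotate (2 + m)) d∈
  ... | e , e∈ , refl with ∈-map⁻ (rotate⁻¹ (2 + m)) (⊆T e∈)
  ...   | d , d∈T , refl = subst (_∈ T) (sym (rotate-rotate⁻¹ d (All.lookup areDiagonals d∈T))) d∈T
  from : T ⊆ rotatedEdges m t
  from {d} d∈ = subst (_∈ rotatedEdges m t) (rotate-rotate⁻¹ d (All.lookup areDiagonals d∈))
    (∈-map⁺ (rotate (2 + m)) (T⊆ (∈-map⁺ (rotate⁻¹ (2 + m)) d∈)))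

triangulations-↭ : ∀ m → map (triangulationOf m) (trees m) ↭ triangulations (2 + m)
triangulations-↭ m = ↭-set
  (map-unique (triangulationOf m) (triangulationOf-injective m) (trees-unique m))
  (Unique.filter⁺ (isTriangulation? (2 + m)) (subsets-unique (diagonals-unique (2 + m))))
  (λ T∈ → let t , t∈ , eq = ∈-map⁻ (triangulationOf m) T∈ in
    subst (_∈ triangulations (2 + m)) (sym eq) (canonical∈triangulations (rotatedEdges-isTriangulation {m} {t} t∈)))
  (λ T∈ → let t , t∈ , eq = triangulationOf-surjective m T∈ in
    subst (_∈ map (triangulationOf m) (trees m)) eq (∈-map⁺ (triangulationOf m) t∈))

-- The two hypotheses say that before the rotation the parallel class is a fibre of a + b. Passing
-- to `canonical` only reorders the rotated edges.
f≡count-edges : ∀ m s x y k →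
  (∀ a b → IsDiagonal (2 + m) (a , b) → Parallel (2 + m) (rotate (2 + m) (a , b)) (x , y) → a + b ≡ s) →
  (∀ a b → IsDiagonal (2 + m) (a , b) → a + b ≡ s → Parallel (2 + m) (rotate (2 + m) (a , b)) (x , y)) →
  f x y (2 + m) k ≡ count (λ t → count (λ (a , b) → a + b) s (edges 0 t)) k (trees m)
f≡count-edges m s x y k to from = begin
  count (parallelCount N (x , y)) k (triangulations N)
    ≡⟨ ↭-length (filter-↭ (λ T → parallelCount N (x , y) T ≟ k) (triangulations-↭ m)) ⟨
  count (parallelCount N (x , y)) k (map (triangulationOf m) (trees m))
    ≡⟨ count-map (parallelCount N (x , y)) k (triangulationOf m) (trees m) ⟩
  count (λ t → parallelCount N (x , y) (triangulationOf m t)) k (trees m)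
    ≡⟨ count-cong k (trees m) (λ {t} → parallel t) ⟩
  count (λ t → count (λ (a , b) → a + b) s (edges 0 t)) k (trees m) ∎
  where
  open ≡-Reasoning
  N = 2 + m
  parallel : ∀ t → t ∈ trees m → parallelCount N (x , y) (triangulationOf m t) ≡ count (λ (a , b) → a + b) s (edges 0 t)
  parallel t t∈ = begin
    length (filter P? (triangulationOf m t))
      ≡⟨ ↭-length (filter-↭ P? (↭-set
           (Unique.filter⁺ (_∈? rotatedEdges m t) (diagonals-unique N)) (rotatedEdges-unique t∈)
           (canonical⊆ N (rotatedEdges m t))
           (⊆canonical (IsTriangulation.areDiagonals (rotatedEdges-isTriangulation t∈))))) ⟩
    length (filter P? (rotatedEdges m t))
      ≡⟨ length-filter-map P? (rotate N) (edges 0 t) ⟩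
    length (filter (P? ∘ rotate N) (edges 0 t))
      ≡⟨ cong length (filter-cong-local (P? ∘ rotate N) (λ (a , b) → a + b ≟ s) (edges 0 t)
           (λ {(a , b)} d∈ → to a b (rotatedEdges-diagonals t∈ d∈))
           (λ {(a , b)} d∈ → from a b (rotatedEdges-diagonals t∈ d∈))) ⟩
    count (λ (a , b) → a + b) s (edges 0 t) ∎
    where
    P? : ∀ d → Dec (Parallel N d (x , y))
    P? d = parallel? N d (x , y)

-- Sums over compositions

open import Data.Integer as ℤ using (ℤ; +_; 0ℤ; 1ℤ)
import Data.Integer.Properties as ℤₚ

sumOver-cong : ∀ {A : Set} (xs : List A) {F G : A → ℤ} → F ≗ G → sumOver xs F ≡ sumOver xs G
sumOver-cong []       eq = refl
sumOver-cong (x ∷ xs) eq = cong₂ ℤ._+_ (eq x) (sumOver-cong xs eq)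

sumOver-++ : ∀ {A : Set} (xs ys : List A) (F : A → ℤ) → sumOver (xs ++ ys) F ≡ sumOver xs F ℤ.+ sumOver ys F
sumOver-++ []       ys F = sym (ℤₚ.+-identityˡ _)
sumOver-++ (x ∷ xs) ys F = trans (cong (ℤ._+_ (F x)) (sumOver-++ xs ys F)) (sym (ℤₚ.+-assoc (F x) _ _))

sumOver-map : ∀ {A B : Set} (φ : A → B) (xs : List A) (F : B → ℤ) → sumOver (map φ xs) F ≡ sumOver xs (F ∘ φ)
sumOver-map φ []       F = refl
sumOver-map φ (x ∷ xs) F = cong (ℤ._+_ (F (φ x))) (sumOver-map φ xs F)

-- Stated for `applyUpTo e` because the tail of `upTo n` is no `upTo`.
sumOver-⊛ : ∀ {A : Set} (G : ℕ → List A) (F : A → ℤ) (u v : Series) e n →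
            (∀ j → sumOver (G (e j)) F ≡ + (u j * v (n ∸ suc j))) →
            sumOver (concatMap G (applyUpTo e n)) F ≡ + (u ⊛ v) n
sumOver-⊛ G F u v e zero    eq = refl
sumOver-⊛ G F u v e (suc n) eq = begin
  sumOver (G (e 0) ++ concatMap G (applyUpTo (e ∘ suc) n)) F
    ≡⟨ sumOver-++ (G (e 0)) _ F ⟩
  sumOver (G (e 0)) F ℤ.+ sumOver (concatMap G (applyUpTo (e ∘ suc) n)) F
    ≡⟨ cong₂ ℤ._+_ (eq 0) (sumOver-⊛ G F (u ∘ suc) v (e ∘ suc) n (eq ∘ suc)) ⟩
  + (u 0 * v n) ℤ.+ + (u ∘ suc ⊛ v) n
    ≡⟨ ℤₚ.pos-+ (u 0 * v n) _ ⟨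
  + (u ⊛ v) (suc n) ∎
  where open ≡-Reasoning

compositions-sum : ∀ m n (F : List ℕ → ℤ) (u v : Series) →
  (∀ j n → sumOver (compositions m n) (λ is → F (suc j ∷ is)) ≡ + (u j * v n)) →
  sumOver (compositions (suc m) n) F ≡ + (u ⊛ v) n
compositions-sum m n F u v eq = sumOver-⊛ _ F u v id n λ j →
  trans (sumOver-map (suc j ∷_) (compositions m (n ∸ suc j)) F) (eq j (n ∸ suc j))

2*[1+i]∸1 : ∀ i → 2 * suc i ∸ 1 ≡ suc (double i)
2*[1+i]∸1 i = trans (lemma i) (cong suc (sym (double≡+ i)))
  where
  lemma : ∀ i → i + (1 + (i + 0)) ≡ 1 + (i + i)
  lemma = solve-∀

c-suc : ∀ i → c (suc i) ≡ + catOdd i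
c-suc i = cong +_ (trans (catalan≡Cat (2 * suc i ∸ 1)) (cong Cat (2*[1+i]∸1 i)))

-- 2^{2i+1} C_i = 2 · 4^i C_i is the sum in `avoiding-explicit`, so the integer difference is the
-- count `avoiding`.
b-suc : ∀ i → b (suc i) ≡ + avoiding i
b-suc i = begin
  + (2 ^ (2 * suc i ∸ 1) * catalan i) ℤ.- c (suc i)
    ≡⟨ cong₂ (λ s t → + s ℤ.- t) explicit (c-suc i) ⟩
  + (avoiding i + catOdd i) ℤ.- + catOdd i
    ≡⟨ cong (ℤ._- + catOdd i) (ℤₚ.pos-+ (avoiding i) (catOdd i)) ⟩
  + avoiding i ℤ.+ + catOdd i ℤ.- + catOdd i
    ≡⟨ ℤₚ.+-assoc (+ avoiding i) (+ catOdd i) (ℤ.- + catOdd i) ⟩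
  + avoiding i ℤ.+ (+ catOdd i ℤ.- + catOdd i)
    ≡⟨ cong (ℤ._+_ (+ avoiding i)) (ℤₚ.+-inverseʳ (+ catOdd i)) ⟩
  + avoiding i ℤ.+ 0ℤ
    ≡⟨ ℤₚ.+-identityʳ _ ⟩
  + avoiding i ∎
  where
  open ≡-Reasoning
  power : ∀ i → 2 ^ double i ≡ 4 ^ i
  power zero    = refl
  power (suc i) = trans (sym (*-assoc 2 2 (2 ^ double i))) (cong (4 *_) (power i))
  explicit : 2 ^ (2 * suc i ∸ 1) * catalan i ≡ avoiding i + catOdd i
  explicit = begin
    2 ^ (2 * suc i ∸ 1) * catalan i ≡⟨ cong₂ (λ s t → 2 ^ s * t) (2*[1+i]∸1 i) (catalan≡Cat i) ⟩
    2 * 2 ^ double i * Cat i        ≡⟨ cong (λ s → 2 * s * Cat i) (power i) ⟩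
    2 * 4 ^ i * Cat i               ≡⟨ *-assoc 2 (4 ^ i) (Cat i) ⟩
    2 * (4 ^ i * Cat i)             ≡⟨ avoiding-explicit i ⟨
    avoiding i + catOdd i           ∎

-- The scalar `r` is general so that the factor of each first part can be absorbed into it along the
-- induction.
sum-powers : ∀ r m n → sumOver (compositions m n) (λ is → + r ℤ.* productOver is c) ≡ + (r * powers m n)
sum-powers r zero zero    = trans (ℤₚ.+-identityʳ (+ r ℤ.* 1ℤ)) (sym (ℤₚ.pos-* r 1))
sum-powers r zero (suc n) = cong +_ (sym (*-zeroʳ r))
sum-powers r (suc m) n = trans
  (compositions-sum m n (λ is → + r ℤ.* productOver is c) (r · catOdd) (powers m) λ j n → trans
    (sumOver-cong (compositions m n) λ is → absorb j (productOver is c))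
    (sum-powers (r * catOdd j) m n))
  (cong +_ (·-⊛-assoc r catOdd (powers m) n))
  where
  open ≡-Reasoning
  absorb : ∀ j p → + r ℤ.* (c (suc j) ℤ.* p) ≡ + (r * catOdd j) ℤ.* p
  absorb j p = begin
    + r ℤ.* (c (suc j) ℤ.* p)     ≡⟨ ℤₚ.*-assoc (+ r) (c (suc j)) p ⟨
    + r ℤ.* c (suc j) ℤ.* p       ≡⟨ cong (λ s → + r ℤ.* s ℤ.* p) (c-suc j) ⟩
    + r ℤ.* + catOdd j ℤ.* p      ≡⟨ cong (ℤ._* p) (ℤₚ.pos-* r (catOdd j)) ⟨
    + (r * catOdd j) ℤ.* p        ∎

sum-b-powers : ∀ r m n →
  sumOver (compositions (suc m) n) (λ is → + r ℤ.* productOver (take 1 is) b ℤ.* productOver (drop 1 is) c) ≡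
  + (r * (avoiding ⊛ powers m) n)
sum-b-powers r m n = trans
  (compositions-sum m n (λ is → + r ℤ.* productOver (take 1 is) b ℤ.* productOver (drop 1 is) c) (r · avoiding) (powers m) λ j n → trans
    (sumOver-cong (compositions m n) λ is → cong (ℤ._* productOver is c) (absorb j))
    (sum-powers (r * avoiding j) m n))
  (cong +_ (·-⊛-assoc r avoiding (powers m) n))
  where
  absorb : ∀ j → + r ℤ.* (b (suc j) ℤ.* 1ℤ) ≡ + (r * avoiding j)
  absorb j = trans (cong (ℤ._*_ (+ r)) (trans (ℤₚ.*-identityʳ (b (suc j))) (b-suc j))) (sym (ℤₚ.pos-* r (avoiding j)))

sum-bb-powers : ∀ r m n →
  sumOver (compositions (suc (suc m)) n) (λ is → + r ℤ.* productOver (take 2 is) b ℤ.* productOver (drop 2 is) c) ≡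
  + (r * (avoiding ⊛ (avoiding ⊛ powers m)) n)
sum-bb-powers r m n = trans
  (compositions-sum (suc m) n (λ is → + r ℤ.* productOver (take 2 is) b ℤ.* productOver (drop 2 is) c) (r · avoiding) (avoiding ⊛ powers m) λ j n → trans
    (sumOver-cong (compositions (suc m) n) λ is →
      cong (ℤ._* productOver (drop 1 is) c) (absorb j (productOver (take 1 is) b)))
    (sum-b-powers (r * avoiding j) m n))
  (cong +_ (·-⊛-assoc r avoiding (avoiding ⊛ powers m) n))
  where
  absorb : ∀ j p → + r ℤ.* (b (suc j) ℤ.* p) ≡ + (r * avoiding j) ℤ.* p
  absorb j p = trans (sym (ℤₚ.*-assoc (+ r) (b (suc j)) p))
    (cong (ℤ._* p) (trans (cong (ℤ._*_ (+ r)) (b-suc j)) (sym (ℤₚ.pos-* r (avoiding j)))))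

-- Parallel classes

∣∧<⇒≡0 : ∀ {N n} → N ∣ n → n < N → n ≡ 0
∣∧<⇒≡0     (divides zero    eq) n<N = eq
∣∧<⇒≡0 {N} (divides (suc q) eq) n<N = contradiction (≤-<-trans (m≤m+n N (q * N)) (subst (_< N) eq n<N)) (<-irrefl refl)

∣∧<2⇒≡ : ∀ {N n} → N ∣ n → 0 < n → n < N + N → n ≡ N
∣∧<2⇒≡     (divides 0 eq)             0<n _   = contradiction 0<n (<-irrefl (sym eq))
∣∧<2⇒≡ {N} (divides 1 eq)             _   _   = trans eq (*-identityˡ N)
∣∧<2⇒≡ {N} (divides (suc (suc q)) eq) _   n<  = contradiction
  (≤-<-trans (subst (N + N ≤_) (sym eq) (+-monoʳ-≤ N (m≤m+n N (q * N)))) n<) (<-irrefl refl)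

+-suc-<2 : ∀ {a b N} → a < b → b < N → suc (a + b) < N + N
+-suc-<2 {a} {b} a<b b<N = +-mono-≤-< (<-trans a<b b<N) b<N

not-initial : ∀ {m b} → IsDiagonal (2 + m) (0 , b) → suc b ≢ 2 + m
not-initial (_ , _ , notSide) eq = notSide (inj₂ (refl , eq))

-- Without wrapping, N divides a + b + 1, which is positive and below 2 N. If b = N - 1, then N
-- divides a, so a = 0 and the segment is the root edge.
parallel-01⁻ : ∀ m a b → IsDiagonal (2 + m) (a , b) → Parallel (2 + m) (rotate (2 + m) (a , b)) (0 , 1) → a + b ≡ suc m
parallel-01⁻ m a b diag@(a<b , b<N , _) par with suc b ≟ 2 + m
... | no _ = suc-injective (∣∧<2⇒≡
  (subst (2 + m ∣_) (trans (∣-∣-identityʳ (a + suc b)) (+-suc a b)) par) z<s (+-suc-<2 a<b b<N))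
... | yes eq with refl ← ∣∧<⇒≡0 (subst (2 + m ∣_) (∣-∣-identityʳ a) par) (<-trans a<b b<N) =
  contradiction eq (not-initial diag)

parallel-01⁺ : ∀ m a b → IsDiagonal (2 + m) (a , b) → a + b ≡ suc m → Parallel (2 + m) (rotate (2 + m) (a , b)) (0 , 1)
parallel-01⁺ m a b diag eq with suc b ≟ 2 + m
... | no _ = subst (2 + m ∣_) (sym (trans (∣-∣-identityʳ (a + suc b)) (trans (+-suc a b) (cong suc eq)))) ∣-refl
... | yes refl with refl ← +-cancelʳ-≡ (suc m) a 0 eq = contradiction refl (not-initial diag)

-- Here a wrapped diagonal can occur: for b = N - 1 the image (0, a + 1) is parallel to 02 only if a
-- = 1, and the sum is N again.
parallel-02⁻ : ∀ m a b → IsDiagonal (2 + m) (a , b) → Parallel (2 + m) (rotate (2 + m) (a , b)) (0 , 2) → a + b ≡ 2 + m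
parallel-02⁻ m a b diag@(a<b , b<N , _) par with suc b ≟ 2 + m
... | no _ = ∣∧<2⇒≡
  (subst (2 + m ∣_) (trans (cong (∣_- 1 ∣) (+-suc a b)) (∣-∣-identityʳ (a + b))) par)
  (≤-trans (≤-<-trans z≤n a<b) (m≤n+m b a)) (<-trans (n<1+n _) (+-suc-<2 a<b b<N))
parallel-02⁻ m zero    b diag par | yes eq = contradiction eq (not-initial diag)
parallel-02⁻ m (suc a) b diag@(a<b , b<N , _) par | yes refl
  with refl ← ∣∧<⇒≡0 (subst (2 + m ∣_) (∣-∣-identityʳ a) par) (<-trans (n<1+n a) (<-trans a<b b<N)) = refl

parallel-02⁺ : ∀ m a b → IsDiagonal (2 + m) (a , b) → a + b ≡ 2 + m → Parallel (2 + m) (rotate (2 + m) (a , b)) (0 , 2)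
parallel-02⁺ m a b diag eq with suc b ≟ 2 + m
... | no _ = subst (2 + m ∣_) (sym (trans (cong (∣_- 1 ∣) (+-suc a b)) (trans (∣-∣-identityʳ (a + b)) eq))) ∣-refl
... | yes refl with refl ← +-cancelʳ-≡ (suc m) a 1 eq = (2 + m) ∣0

-- Values of `f` and assembly of the theorem

f-01 : ∀ m k → f 0 1 (2 + m) k ≡ count (central (suc m)) k (trees m)
f-01 m k = trans (f≡count-edges m (suc m) 0 1 k (parallel-01⁻ m) (parallel-01⁺ m))
  (count-cong k (trees m) λ {t} _ → edges-central (suc m) 0 t)

f-02 : ∀ m k → f 0 2 (2 + m) k ≡ count (central (2 + m)) k (trees m)
f-02 m k = trans (f≡count-edges m (2 + m) 0 2 k (parallel-02⁻ m) (parallel-02⁺ m))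
  (count-cong k (trees m) λ {t} _ → edges-central (2 + m) 0 t)

f-01-even : ∀ x k → f 0 1 (2 * suc (suc x)) k ≡ 2 ^ suc k * powers (suc k) (suc x)
f-01-even x k = begin
  f 0 1 (2 * suc (suc x)) k                       ≡⟨ cong (λ N → f 0 1 N k) (lemma x) ⟩
  f 0 1 (2 + (suc x + suc x)) k                   ≡⟨ f-01 (suc x + suc x) k ⟩
  count (central (suc (suc x + suc x))) k (trees (suc x + suc x))
    ≡⟨ cong (λ d → count (central (suc d)) k (trees (suc x + suc x))) (double≡+ (suc x)) ⟨
  -- The root edge lies on the line x = y, so `evenDiagonal` counts it as one more central edge:
  -- hence the exponent k + 1.
  evenCount k (suc x) (suc x)                     ≡⟨ evenDiagonal≡ (suc k) (suc x) ⟩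
  2 ^ suc k * powers (suc k) (suc x)              ∎
  where
  open ≡-Reasoning
  lemma : ∀ x → 2 * (2 + x) ≡ 2 + ((1 + x) + (1 + x))
  lemma = solve-∀

f-02-even : ∀ x k → f 0 2 (2 * suc (suc x)) (suc k) ≡ 2 ^ k * (avoiding ⊛ (avoiding ⊛ powers k)) (suc (suc x))
f-02-even x k = begin
  f 0 2 (2 * suc (suc x)) (suc k)                 ≡⟨ cong (λ N → f 0 2 N (suc k)) (lemma x) ⟩
  f 0 2 (2 + suc (suc x + x)) (suc k)             ≡⟨ f-02 (suc (suc x + x)) (suc k) ⟩
  count (central (3 + (suc x + x))) (suc k) (trees (suc (suc x + x)))
    ≡⟨ cong (λ d → count (central (4 + d)) (suc k) (trees (suc (suc x + x)))) (double≡+ x) ⟨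
  -- The centre is the vertex x + 2, at distances x + 2 and x + 1 from the ends 0 and 2 x + 3 of the
  -- root edge.
  oddCount (suc k) (suc x) x                      ≡⟨ oddCount-near k x ⟩
  -- The inner series `avoiding ⊛ powers k` starts with 0, so the last term of the outer convolution
  -- vanishes and the index can be raised by one.
  2 ^ k * (avoiding ⋆ (avoiding ⋆ powers k)) x    ≡⟨ cong (λ s → 2 ^ k * (s + (avoiding ⋆ (avoiding ⋆ powers k)) x)) (*-zeroʳ (avoiding (suc x))) ⟨
  2 ^ k * (avoiding (suc x) * 0 + (avoiding ⋆ (avoiding ⋆ powers k)) x)
    ≡⟨ cong (2 ^ k *_) (⊛-last avoiding (avoiding ⊛ powers k) (suc x)) ⟨
  2 ^ k * (avoiding ⊛ (avoiding ⊛ powers k)) (suc (suc x)) ∎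
  where
  open ≡-Reasoning
  lemma : ∀ x → 2 * (2 + x) ≡ 2 + (1 + ((1 + x) + x))
  lemma = solve-∀

f-01-odd : ∀ x k → f 0 1 (2 * suc x + 1) k ≡ 2 ^ k * (avoiding ⊛ powers k) (suc x)
f-01-odd x k = begin
  f 0 1 (2 * suc x + 1) k                         ≡⟨ cong (λ N → f 0 1 N k) (lemma x) ⟩
  f 0 1 (2 + suc (x + x)) k                       ≡⟨ f-01 (suc (x + x)) k ⟩
  count (central (2 + (x + x))) k (trees (suc (x + x)))
    ≡⟨ cong (λ d → count (central (2 + d)) k (trees (suc (x + x)))) (double≡+ x) ⟨
  oddCount k x x                                  ≡⟨ oddDiagonal≡ k x ⟩
  2 ^ k * (avoiding ⋆ powers k) x                 ∎
  where
  open ≡-Reasoning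
  lemma : ∀ x → 2 * (1 + x) + 1 ≡ 2 + (1 + (x + x))
  lemma = solve-∀

theorem4 : (∀ (n k : ℕ) → 2 ≤ n → 1 ≤ k →
    + f 0 1 (2 * n) k ≡
    sumOver (compositions (k + 1) (n ∸ 1)) (λ is →
    + (2 ^ (k + 1)) ℤ.* productOver is c))
    ×
    (∀ (n k : ℕ) → 2 ≤ n → 1 ≤ k →
    + f 0 2 (2 * n) k ≡
    sumOver (compositions (k + 1) n) (λ is →
    + (2 ^ (k ∸ 1)) ℤ.* productOver (take 2 is) b ℤ.* productOver (drop 2 is) c))
    ×
    (∀ (n k : ℕ) → 1 ≤ n → 1 ≤ k →
    + f 0 1 (2 * n + 1) k ≡
    sumOver (compositions (k + 1) n) (λ is →
    + (2 ^ k) ℤ.* productOver (take 1 is) b ℤ.* productOver (drop 1 is) c))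
theorem4 = part₁ , part₂ , part₃
  where
  part₁ : ∀ (n k : ℕ) → 2 ≤ n → 1 ≤ k →
    + f 0 1 (2 * n) k ≡
    sumOver (compositions (k + 1) (n ∸ 1)) (λ is → + (2 ^ (k + 1)) ℤ.* productOver is c)
  part₁ (suc (suc x)) k _ _ rewrite +-comm k 1 =
    trans (cong +_ (f-01-even x k)) (sym (sum-powers (2 ^ suc k) (suc k) (suc x)))
  part₁ (suc zero) _ (s≤s ()) _

  part₂ : ∀ (n k : ℕ) → 2 ≤ n → 1 ≤ k →
    + f 0 2 (2 * n) k ≡
    sumOver (compositions (k + 1) n) (λ is →
      + (2 ^ (k ∸ 1)) ℤ.* productOver (take 2 is) b ℤ.* productOver (drop 2 is) c)
  part₂ (suc (suc x)) (suc k) _ _ rewrite +-comm k 1 =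
    trans (cong +_ (f-02-even x k)) (sym (sum-bb-powers (2 ^ k) k (suc (suc x))))
  part₂ (suc zero) _ (s≤s ()) _

  part₃ : ∀ (n k : ℕ) → 1 ≤ n → 1 ≤ k →
    + f 0 1 (2 * n + 1) k ≡
    sumOver (compositions (k + 1) n) (λ is →
      + (2 ^ k) ℤ.* productOver (take 1 is) b ℤ.* productOver (drop 1 is) c)
  part₃ (suc x) k _ _ rewrite +-comm k 1 =
    trans (cong +_ (f-01-odd x k)) (sym (sum-b-powers (2 ^ k) k (suc x)))
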